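{- There is no valid encoding from the full $\pi$-calculus (with free choice and the match prefix $[a=b]P$) into its variant without the match prefix.
   Context: The full $\pi$-calculus has processes $P ::= \mathbf{0} \mid x(z).P \mid \overline{x}\langle y\rangle.P \mid \tau.P \mid [a=b]P \mid P_1+P_2 \mid P_1 \mid P_2 \mid (\nu z)P \mid\ !P \mid \checkmark$ (where $\checkmark$ denotes success); the variant without match omits $[a=b]P$. Both use the standard reduction semantics $\longrightarrow$ with structural congruence (in the full calculus including $[a=a]P \equiv P$); $\longrightarrow^*$ is the reflexive–transitive closure. A term reaches success if it reduces ($\longrightarrow^*$) to a term having $\checkmark$ as an unguarded subterm (unguarded: not under an input/output/$\tau$ prefix or an unsatisfied match). An encoding is a triple $([\![\cdot]\!], \varphi, \asymp)$ with translation $[\![\cdot]\!]$ from source to target terms, renaming policy $\varphi$ mapping each name to a vector of names of fixed length $k$ with $\varphi(u)\cap\varphi(v)=\emptyset$ for $u\neq v$, and $\asymp$ a success-respecting reduction bisimulation on target terms. It is valid (Gorla's criteria) if it satisfies: compositionality (for each $k$-ary operator $\mathrm{op}$ and set of names $N$ there is a $k$-ary target context $C^{\mathrm{op}}_N$ with $[\![\mathrm{op}(S_1,\dots,S_k)]\!] = C^{\mathrm{op}}_N([\![S_1]\!],\dots,[\![S_k]\!])$ whenever the free names of $S_1,\dots,S_k$ are $N$); name invariance ($[\![\sigma(S)]\!] = \sigma'([\![S]\!])$ if $\sigma$ injective, $\asymp \sigma'([\![S]\!])$ otherwise, where $\varphi(\sigma(a)) = \sigma'(\varphi(a))$ for all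 names $a$); operational correspondence (complete: $S \longrightarrow^* S'$ implies $[\![S]\!] \longrightarrow^* \asymp [\![S']\!]$; sound: $[\![S]\!] \longrightarrow^* T$ implies some $S \longrightarrow^* S'$ with $T \longrightarrow^* \asymp [\![S']\!]$); divergence reflection ($[\![S]\!]$ has an infinite reduction sequence only if $S$ does); success sensitiveness ($S$ reaches success iff $[\![S]\!]$ does). -}

module Defs where

open import Data.Bool using (Bool; true; false; T; if_then_else_)
open import Data.Nat using (ℕ; zero; suc; _≡ᵇ_)
open import Data.Fin using (Fin; zero; suc)
open import Data.Vec using (Vec) renaming (map to vmap)
open import Data.Vec.Membership.Propositional renaming (_∈_ to _∈ᵥ_)
open import Data.List using (List)
open import Data.List.Membership.Propositional using (_∈_)
open import Data.Product using (Σ; ∃; ∃-syntax; _×_; _,_)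
open import Data.Sum using (_⊎_)
open import Data.Unit using (⊤)
open import Data.Empty using (⊥)
open import Function.Bundles using (_⇔_)
open import Relation.Nullary using (¬_)
open import Relation.Binary.PropositionalEquality using (_≡_; _≢_)
open import Relation.Binary.Construct.Closure.ReflexiveTransitive using (Star)

-- Names.  Free names are atoms from ℕ (an infinite set of names);
-- bound names are de Bruijn indices (so α-equivalent terms are equal).

data Nm (n : ℕ) : Set where
  fr : ℕ → Nm n
  bd : Fin n → Nm n

-- Processes.  The flag m says whether the match prefix is available:
-- m = true : full π-calculus,  m = false : the variant without match
-- (the constructor `mat` then needs an element of T false = ⊥).

data Proc (m : Bool) (n : ℕ) : Set where
  nil  : Proc m n
  inp  : Nm n → Proc m (suc n) → Proc m n
  out  : Nm n → Nm n → Proc m n → Proc m n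
  tau  : Proc m n → Proc m n
  mat  : T m → Nm n → Nm n → Proc m n → Proc m n
  _⊕_  : Proc m n → Proc m n → Proc m n
  _∥_  : Proc m n → Proc m n → Proc m n
  new  : Proc m (suc n) → Proc m n
  bang : Proc m n → Proc m n
  ok   : Proc m n

infixr 6 _⊕_
infixr 5 _∥_

Term : Bool → Set
Term m = Proc m 0

-- Renaming (names are the only things substituted in the π-calculus).

wkN : ∀ {n} → Nm n → Nm (suc n)
wkN (fr a) = fr a
wkN (bd i) = bd (suc i)

ext : ∀ {n k} → (Nm n → Nm k) → Nm (suc n) → Nm (suc k)
ext ρ (bd zero)    = bd zero
ext ρ (bd (suc i)) = wkN (ρ (bd i))
ext ρ (fr a)       = wkN (ρ (fr a))

rename : ∀ {m n k} → (Nm n → Nm k) → Proc m n → Proc m k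
rename ρ nil         = nil
rename ρ (inp x P)   = inp (ρ x) (rename (ext ρ) P)
rename ρ (out x y P) = out (ρ x) (ρ y) (rename ρ P)
rename ρ (tau P)     = tau (rename ρ P)
rename ρ (mat t a b P) = mat t (ρ a) (ρ b) (rename ρ P)
rename ρ (P ⊕ Q)     = rename ρ P ⊕ rename ρ Q
rename ρ (P ∥ Q)     = rename ρ P ∥ rename ρ Q
rename ρ (new P)     = new (rename (ext ρ) P)
rename ρ (bang P)    = bang (rename ρ P)
rename ρ ok          = ok

wk : ∀ {m n} → Proc m n → Proc m (suc n)
wk = rename wkN

sub0N : ∀ {n} → Nm n → Nm (suc n) → Nm n
sub0N y (bd zero)    = y
sub0N y (bd (suc i)) = bd i
sub0N y (fr a)       = fr a

_[_] : ∀ {m n} → Proc m (suc n) → Nm n → Proc m n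
P [ y ] = rename (sub0N y) P

swapN : ∀ {n} → Nm (suc (suc n)) → Nm (suc (suc n))
swapN (bd zero)          = bd (suc zero)
swapN (bd (suc zero))    = bd zero
swapN (bd (suc (suc i))) = bd (suc (suc i))
swapN (fr a)             = fr a

closeN : ∀ {n} → ℕ → Nm n → Nm (suc n)
closeN w (fr a) = if a ≡ᵇ w then bd zero else fr a
closeN w (bd i) = bd (suc i)

close : ∀ {m n} → ℕ → Proc m n → Proc m (suc n)
close w = rename (closeN w)

substN : ∀ {n} → (ℕ → ℕ) → Nm n → Nm n
substN σ (fr a) = fr (σ a)
substN σ (bd i) = bd i

applySub : ∀ {m n} → (ℕ → ℕ) → Proc m n → Proc m n
applySub σ = rename (substN σ)

inpT : ∀ {m} → ℕ → ℕ → Term m → Term m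
inpT x z P = inp (fr x) (close z P)

outT : ∀ {m} → ℕ → ℕ → Term m → Term m
outT x y P = out (fr x) (fr y) P

newT : ∀ {m} → ℕ → Term m → Term m
newT z P = new (close z P)

matT : ∀ {m} → T m → ℕ → ℕ → Term m → Term m
matT t a b P = mat t (fr a) (fr b) P

FreeInN : ∀ {n} → ℕ → Nm n → Set
FreeInN a (fr b) = a ≡ b
FreeInN a (bd _) = ⊥

FreeIn : ∀ {m n} → ℕ → Proc m n → Set
FreeIn a nil           = ⊥
FreeIn a (inp x P)     = FreeInN a x ⊎ FreeIn a P
FreeIn a (out x y P)   = FreeInN a x ⊎ (FreeInN a y ⊎ FreeIn a P)
FreeIn a (tau P)       = FreeIn a P
FreeIn a (mat _ b c P) = FreeInN a b ⊎ (FreeInN a c ⊎ FreeIn a P)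
FreeIn a (P ⊕ Q)       = FreeIn a P ⊎ FreeIn a Q
FreeIn a (P ∥ Q)       = FreeIn a P ⊎ FreeIn a Q
FreeIn a (new P)       = FreeIn a P
FreeIn a (bang P)      = FreeIn a P
FreeIn a ok            = ⊥

-- Structural congruence (α-conversion is built into the syntax).

infix 4 _≡ₛ_
data _≡ₛ_ {m : Bool} : ∀ {n} → Proc m n → Proc m n → Set where
  refl≡  : ∀ {n} {P : Proc m n} → P ≡ₛ P
  sym≡   : ∀ {n} {P Q : Proc m n} → P ≡ₛ Q → Q ≡ₛ P
  trans≡ : ∀ {n} {P Q R : Proc m n} → P ≡ₛ Q → Q ≡ₛ R → P ≡ₛ R
  c-inp  : ∀ {n} {x} {P Q : Proc m (suc n)} → P ≡ₛ Q → inp x P ≡ₛ inp x Q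
  c-out  : ∀ {n} {x y} {P Q : Proc m n} → P ≡ₛ Q → out x y P ≡ₛ out x y Q
  c-tau  : ∀ {n} {P Q : Proc m n} → P ≡ₛ Q → tau P ≡ₛ tau Q
  c-mat  : ∀ {n} {t a b} {P Q : Proc m n} → P ≡ₛ Q → mat t a b P ≡ₛ mat t a b Q
  c-sumˡ : ∀ {n} {P Q R : Proc m n} → P ≡ₛ Q → P ⊕ R ≡ₛ Q ⊕ R
  c-sumʳ : ∀ {n} {P Q R : Proc m n} → P ≡ₛ Q → R ⊕ P ≡ₛ R ⊕ Q
  c-parˡ : ∀ {n} {P Q R : Proc m n} → P ≡ₛ Q → P ∥ R ≡ₛ Q ∥ R
  c-parʳ : ∀ {n} {P Q R : Proc m n} → P ≡ₛ Q → R ∥ P ≡ₛ R ∥ Q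
  c-new  : ∀ {n} {P Q : Proc m (suc n)} → P ≡ₛ Q → new P ≡ₛ new Q
  c-bang : ∀ {n} {P Q : Proc m n} → P ≡ₛ Q → bang P ≡ₛ bang Q
  par-unit  : ∀ {n} {P : Proc m n} → P ∥ nil ≡ₛ P
  par-comm  : ∀ {n} {P Q : Proc m n} → P ∥ Q ≡ₛ Q ∥ P
  par-assoc : ∀ {n} {P Q R : Proc m n} → (P ∥ Q) ∥ R ≡ₛ P ∥ (Q ∥ R)
  sum-unit  : ∀ {n} {P : Proc m n} → P ⊕ nil ≡ₛ P
  sum-comm  : ∀ {n} {P Q : Proc m n} → P ⊕ Q ≡ₛ Q ⊕ P
  sum-assoc : ∀ {n} {P Q R : Proc m n} → (P ⊕ Q) ⊕ R ≡ₛ P ⊕ (Q ⊕ R)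
  new-nil   : ∀ {n} → new {m} {n} nil ≡ₛ nil
  new-swap  : ∀ {n} {P : Proc m (suc (suc n))} → new (new P) ≡ₛ new (new (rename swapN P))
  new-par   : ∀ {n} {P : Proc m n} {Q : Proc m (suc n)} → new (wk P ∥ Q) ≡ₛ P ∥ new Q
  bang-unf  : ∀ {n} {P : Proc m n} → bang P ≡ₛ P ∥ bang P
  mat-refl  : ∀ {n} {t} {a : Nm n} {P : Proc m n} → mat t a a P ≡ₛ P

infix 4 _⟶_
data _⟶_ {m : Bool} : ∀ {n} → Proc m n → Proc m n → Set where
  r-com   : ∀ {n} {x y : Nm n} {P : Proc m (suc n)} {Q M N : Proc m n} →
            (inp x P ⊕ M) ∥ (out x y Q ⊕ N) ⟶ (P [ y ]) ∥ Q
  r-tau   : ∀ {n} {P M : Proc m n} → tau P ⊕ M ⟶ P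
  r-par   : ∀ {n} {P P' Q : Proc m n} → P ⟶ P' → P ∥ Q ⟶ P' ∥ Q
  r-new   : ∀ {n} {P P' : Proc m (suc n)} → P ⟶ P' → new P ⟶ new P'
  r-struc : ∀ {n} {P P' Q Q' : Proc m n} → P ≡ₛ P' → P' ⟶ Q' → Q' ≡ₛ Q → P ⟶ Q

infix 4 _⟶*_
_⟶*_ : ∀ {m n} → Proc m n → Proc m n → Set
_⟶*_ = Star _⟶_

Unguarded✓ : ∀ {m n} → Proc m n → Set
Unguarded✓ nil           = ⊥
Unguarded✓ (inp _ _)     = ⊥
Unguarded✓ (out _ _ _)   = ⊥
Unguarded✓ (tau _)       = ⊥
Unguarded✓ (mat _ a b P) = a ≡ b × Unguarded✓ P
Unguarded✓ (P ⊕ Q)       = Unguarded✓ P ⊎ Unguarded✓ Q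
Unguarded✓ (P ∥ Q)       = Unguarded✓ P ⊎ Unguarded✓ Q
Unguarded✓ (new P)       = Unguarded✓ P
Unguarded✓ (bang P)      = Unguarded✓ P
Unguarded✓ ok            = ⊤

ReachesSuccess : ∀ {m} → Term m → Set
ReachesSuccess P = ∃[ P' ] (P ⟶* P' × Unguarded✓ P')

Diverges : ∀ {m} → Term m → Set
Diverges {m} P = Σ (ℕ → Term m) λ f → f 0 ≡ P × (∀ i → f i ⟶ f (suc i))

record IsSuccRespRedBisim {m : Bool} (_≍_ : Term m → Term m → Set) : Set where
  field
    sim-l   : ∀ {T₁ T₂ T₁'} → T₁ ≍ T₂ → T₁ ⟶ T₁' → ∃[ T₂' ] (T₂ ⟶* T₂' × T₁' ≍ T₂')
    sim-r   : ∀ {T₁ T₂ T₂'} → T₁ ≍ T₂ → T₂ ⟶ T₂' → ∃[ T₁' ] (T₁ ⟶* T₁' × T₁' ≍ T₂')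
    succ-resp : ∀ {T₁ T₂} → T₁ ≍ T₂ → ReachesSuccess T₁ ⇔ ReachesSuccess T₂

data Op : ℕ → Set where
  o-nil  : Op 0
  o-inp  : ℕ → ℕ → Op 1
  o-out  : ℕ → ℕ → Op 1
  o-tau  : Op 1
  o-mat  : ℕ → ℕ → Op 1
  o-sum  : Op 2
  o-par  : Op 2
  o-new  : ℕ → Op 1
  o-bang : Op 1
  o-ok   : Op 0

applyOp : ∀ {k} → Op k → (Fin k → Term true) → Term true
applyOp o-nil       S = nil
applyOp (o-inp x z) S = inpT x z (S zero)
applyOp (o-out x y) S = outT x y (S zero)
applyOp o-tau       S = tau (S zero)
applyOp (o-mat a b) S = matT _ a b (S zero)
applyOp o-sum       S = S zero ⊕ S (suc zero)
applyOp o-par       S = S zero ∥ S (suc zero)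
applyOp (o-new z)   S = newT z (S zero)
applyOp o-bang      S = bang (S zero)
applyOp o-ok        S = ok

-- k-hole contexts of a calculus, with named binders; filling the holes
-- is capturing (binders of the context may bind names of the fillers).

data Ctx (m : Bool) (k : ℕ) : Set where
  hole : Fin k → Ctx m k
  nil  : Ctx m k
  inp  : ℕ → ℕ → Ctx m k → Ctx m k
  out  : ℕ → ℕ → Ctx m k → Ctx m k
  tau  : Ctx m k → Ctx m k
  mat  : T m → ℕ → ℕ → Ctx m k → Ctx m k
  sum  : Ctx m k → Ctx m k → Ctx m k
  par  : Ctx m k → Ctx m k → Ctx m k
  new  : ℕ → Ctx m k → Ctx m k
  bang : Ctx m k → Ctx m k
  ok   : Ctx m k

fill : ∀ {m k} → Ctx m k → (Fin k → Term m) → Term m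
fill (hole i)      T = T i
fill nil           T = nil
fill (inp x z C)   T = inpT x z (fill C T)
fill (out x y C)   T = outT x y (fill C T)
fill (tau C)       T = tau (fill C T)
fill (mat t a b C) T = matT t a b (fill C T)
fill (sum C D)     T = fill C T ⊕ fill D T
fill (par C D)     T = fill C T ∥ fill D T
fill (new z C)     T = newT z (fill C T)
fill (bang C)      T = bang (fill C T)
fill ok            T = ok

-- Valid encodings (Gorla's criteria) from the full π-calculus (true)
-- into the π-calculus without match (false).

Source = Term true
Target = Term false

Injective : (ℕ → ℕ) → Set
Injective σ = ∀ {a b} → σ a ≡ σ b → a ≡ b

record ValidEncoding : Set₁ where
  field
    ⟦_⟧  : Source → Target
    k    : ℕ
    φ    : ℕ → Vec ℕ k
    _≍_  : Target → Target → Set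
    φ-disjoint : ∀ {u v} → u ≢ v → ∀ {a} → a ∈ᵥ φ u → ¬ (a ∈ᵥ φ v)
    ≍-bisim : IsSuccRespRedBisim _≍_
    compositional :
      ∀ {n} (op : Op n) (N : List ℕ) → Σ (Ctx false n) λ C →
        ∀ (S : Fin n → Source) →
          (∀ a → (a ∈ N) ⇔ (∃[ i ] FreeIn a (S i))) →
          ⟦ applyOp op S ⟧ ≡ fill C (λ i → ⟦ S i ⟧)
    name-invariance :
      ∀ (S : Source) (σ : ℕ → ℕ) → ∃[ σ' ]
        ((∀ a → φ (σ a) ≡ vmap σ' (φ a)) ×
         (Injective σ → ⟦ applySub σ S ⟧ ≡ applySub σ' ⟦ S ⟧) ×
         (¬ Injective σ → ⟦ applySub σ S ⟧ ≍ applySub σ' ⟦ S ⟧))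
    complete : ∀ {S S' : Source} → S ⟶* S' → ∃[ T ] (⟦ S ⟧ ⟶* T × T ≍ ⟦ S' ⟧)
    sound    : ∀ {S : Source} {T : Target} → ⟦ S ⟧ ⟶* T →
               ∃[ S' ] ∃[ T' ] (S ⟶* S' × T ⟶* T' × T' ≍ ⟦ S' ⟧)
    div-reflect : ∀ {S : Source} → Diverges ⟦ S ⟧ → Diverges S
    succ-sens   : ∀ {S : Source} → ReachesSuccess S ⇔ ReachesSuccess ⟦ S ⟧

{-# OPTIONS --safe #-}
module Submission where

-- In P ∥ Q ⊕ R with P, Q and R all active (not ≡ₛ nil), neither P nor Q can
-- act, but as soon as one of P, Q is inert the other becomes a summand.  With
-- match, [a=b]nil turns inert when a and b are identified; without match,
-- inertness and the summands offered by a term are stable under renaming.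
--
-- Let t₁ and t₂ consist of the test [1=0]nil in parallel with one, resp. two,
-- copies of τ.✓.  Both succeed on their own.  Placed in a sum with τ.0 under an
-- input that receives 0 for 1, t₁ still succeeds but t₂ is blocked.  By
-- compositionality their translations T₁ and T₂ are plugged into the same target
-- context.  As T₂ succeeds wherever it runs as a thread, the context can treat
-- T₂ worse than T₁ only inside a sum: through the free names of T₁, its
-- inertness, an unguarded ✓, or a prefix that it offers.  The first three are
-- disjunctions over the components of a term and do not distinguish one copy
-- from two.  The last is impossible: an offering T₁ that succeeds has a τ-summand
-- leading to success, so the context that translates a sum of t₁, blocked, would
-- not tell it from one with a further summand that is able to act.

open import Defs
open import Data.Bool using (Bool; true; false; T)
open import Data.Empty using (⊥; ⊥-elim)
open import Data.Fin using (Fin; zero; suc)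
open import Data.List using (List; []; _∷_; _++_; map)
open import Data.List.Properties using (map-++)
open import Data.List.Relation.Binary.Pointwise as Pointwise using (Pointwise; []; _∷_)
open import Data.List.Membership.Propositional using (_∈_)
open import Data.List.Relation.Unary.Any using (here; there)
open import Data.Nat using (ℕ; zero; suc; _≡ᵇ_)
open import Data.Nat.Properties using (≡ᵇ⇒≡; ≡⇒≡ᵇ)
open import Data.Product as Product using (∃; ∃-syntax; _×_; _,_; proj₁; proj₂)
open import Data.Product.Function.NonDependent.Propositional using () renaming (_×-⇔_ to ×-⇔)
open import Data.Sum as Sum using (_⊎_; inj₁; inj₂; [_,_]′)
open import Data.Sum.Function.Propositional using () renaming (_⊎-⇔_ to ⊎-⇔)
open import Data.Unit using (⊤; tt)
open import Function.Base using (_∘_; id)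
open import Function.Bundles using (_⇔_; mk⇔; Equivalence)
open import Function.Construct.Composition using (_⇔-∘_)
open import Function.Construct.Identity using (⇔-id)
open import Function.Construct.Symmetry using (⇔-sym)
open import Relation.Binary.Construct.Closure.ReflexiveTransitive using (ε; _◅_)
open import Relation.Binary.PropositionalEquality using (_≡_; _≢_; refl; sym; trans; cong; cong₂; subst; subst₂)
open import Relation.Nullary using (¬_)

-- The encoding is unknown, so its contexts can be compared only when they coincide: the source
-- terms are built by repeating the same operators over the same free names, giving nested instances
-- such as C(win, nil) and C(win, C(win, nil)) of one context C.
--
-- On the target side the obstacle is `≡ₛ`: reductions may use it anywhere, and its unit laws turn
-- parallel compositions into summands and back. Success is therefore recast as the syntax-directed
-- `Win`, whose invariance under `≡ₛ` is the main burden. Its bound counts τ and communication steps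
-- only; this lets the invariance for a prefix appeal to the invariance of its continuation at a
-- smaller bound. On the source side inertness depends on which names coincide, so failure is shown
-- there by another invariant, `Safe`, which evaluates matches under a valuation.
--
-- The preorder `≼` transfers success in one direction only: once T₂ stands as a thread it wins
-- alone and need not simulate T₁ any further.

private variable
  m : Bool
  n n' j l d e : ℕ

-- Renaming

wkN-inj : {x y : Nm n} → wkN x ≡ wkN y → x ≡ y
wkN-inj {x = fr _} {fr _} refl = refl
wkN-inj {x = bd _} {bd _} refl = refl

ext-wkN : (ρ : Nm n → Nm j) (x : Nm n) → ext ρ (wkN x) ≡ wkN (ρ x)
ext-wkN ρ (fr _) = refl
ext-wkN ρ (bd _) = refl

ext-∘ : {ρ : Nm j → Nm l} {θ : Nm n → Nm j} {ζ : Nm n → Nm l} →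
  (∀ x → ρ (θ x) ≡ ζ x) → ∀ x → ext ρ (ext θ x) ≡ ext ζ x
ext-∘ h (bd zero) = refl
ext-∘ {ρ = ρ} {θ} h (bd (suc i)) = trans (ext-wkN ρ (θ (bd i))) (cong wkN (h (bd i)))
ext-∘ {ρ = ρ} {θ} h (fr a) = trans (ext-wkN ρ (θ (fr a))) (cong wkN (h (fr a)))

ext-id : {ρ : Nm n → Nm n} → (∀ x → ρ x ≡ x) → ∀ x → ext ρ x ≡ x
ext-id h (bd zero) = refl
ext-id h (bd (suc i)) = cong wkN (h (bd i))
ext-id h (fr a) = cong wkN (h (fr a))

cong₃ : ∀ {A B C D : Set} (f : A → B → C → D) {a a' b b' c c'} →
  a ≡ a' → b ≡ b' → c ≡ c' → f a b c ≡ f a' b' c'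
cong₃ f refl refl refl = refl

rename-∘ : {ρ : Nm j → Nm l} {θ : Nm n → Nm j} {ζ : Nm n → Nm l} →
  (∀ x → ρ (θ x) ≡ ζ x) → (P : Proc m n) → rename ρ (rename θ P) ≡ rename ζ P
rename-∘ h nil = refl
rename-∘ h (inp x P) = cong₂ inp (h x) (rename-∘ (ext-∘ h) P)
rename-∘ h (out x y P) = cong₃ out (h x) (h y) (rename-∘ h P)
rename-∘ h (tau P) = cong tau (rename-∘ h P)
rename-∘ h (mat t a b P) = cong₃ (mat t) (h a) (h b) (rename-∘ h P)
rename-∘ h (P ⊕ Q) = cong₂ _⊕_ (rename-∘ h P) (rename-∘ h Q)
rename-∘ h (P ∥ Q) = cong₂ _∥_ (rename-∘ h P) (rename-∘ h Q)
rename-∘ h (new P) = cong new (rename-∘ (ext-∘ h) P)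
rename-∘ h (bang P) = cong bang (rename-∘ h P)
rename-∘ h ok = refl

rename-id : {ρ : Nm n → Nm n} → (∀ x → ρ x ≡ x) → (P : Proc m n) → rename ρ P ≡ P
rename-id h nil = refl
rename-id h (inp x P) = cong₂ inp (h x) (rename-id (ext-id h) P)
rename-id h (out x y P) = cong₃ out (h x) (h y) (rename-id h P)
rename-id h (tau P) = cong tau (rename-id h P)
rename-id h (mat t a b P) = cong₃ (mat t) (h a) (h b) (rename-id h P)
rename-id h (P ⊕ Q) = cong₂ _⊕_ (rename-id h P) (rename-id h Q)
rename-id h (P ∥ Q) = cong₂ _∥_ (rename-id h P) (rename-id h Q)
rename-id h (new P) = cong new (rename-id (ext-id h) P)
rename-id h (bang P) = cong bang (rename-id h P)
rename-id h ok = refl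

rename-square : {ρ : Nm j → Nm l} {θ : Nm n → Nm j} {ρ' : Nm n' → Nm l} {θ' : Nm n → Nm n'} →
  (∀ x → ρ (θ x) ≡ ρ' (θ' x)) → (P : Proc m n) →
  rename ρ (rename θ P) ≡ rename ρ' (rename θ' P)
rename-square h P = trans (rename-∘ h P) (sym (rename-∘ (λ _ → refl) P))

rename-wk : (ρ : Nm n → Nm j) (P : Proc m n) → rename (ext ρ) (wk P) ≡ wk (rename ρ P)
rename-wk ρ = rename-square (ext-wkN ρ)

ext-sub0 : (ρ : Nm n → Nm j) (y : Nm n) (x : Nm (suc n)) →
  ρ (sub0N y x) ≡ sub0N (ρ y) (ext ρ x)
ext-sub0 ρ y (bd zero) = refl
ext-sub0 ρ y (bd (suc i)) with ρ (bd i)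
... | fr _ = refl
... | bd _ = refl
ext-sub0 ρ y (fr a) with ρ (fr a)
... | fr _ = refl
... | bd _ = refl

rename-[] : (ρ : Nm n → Nm j) (P : Proc m (suc n)) (y : Nm n) →
  rename ρ (P [ y ]) ≡ rename (ext ρ) P [ ρ y ]
rename-[] ρ P y = rename-square (ext-sub0 ρ y) P

sub0-wk : (y : Nm n) (x : Nm n) → sub0N y (wkN x) ≡ x
sub0-wk y (fr _) = refl
sub0-wk y (bd _) = refl

wk-[] : (P : Proc m n) (y : Nm n) → wk P [ y ] ≡ P
wk-[] P y = trans (rename-∘ (sub0-wk y) P) (rename-id (λ _ → refl) P)

wk-injective : {P Q : Proc m n} → wk P ≡ wk Q → P ≡ Q
wk-injective {P = P} {Q} e =
  trans (sym (wk-[] P (fr 0))) (trans (cong (_[ fr 0 ]) e) (wk-[] Q (fr 0)))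

swap-swap : (x : Nm (suc (suc n))) → swapN (swapN x) ≡ x
swap-swap (bd zero) = refl
swap-swap (bd (suc zero)) = refl
swap-swap (bd (suc (suc i))) = refl
swap-swap (fr a) = refl

swap-extwk : (x : Nm (suc n)) → swapN (ext wkN x) ≡ wkN x
swap-extwk (bd zero) = refl
swap-extwk (bd (suc i)) = refl
swap-extwk (fr a) = refl

swap-wkwk : (x : Nm n) → swapN (wkN (wkN x)) ≡ wkN (wkN x)
swap-wkwk (bd i) = refl
swap-wkwk (fr a) = refl

swap-ext : (ρ : Nm n → Nm j) (x : Nm (suc (suc n))) →
  ext (ext ρ) (swapN x) ≡ swapN (ext (ext ρ) x)
swap-ext ρ (bd zero) = refl
swap-ext ρ (bd (suc zero)) = refl
swap-ext ρ (bd (suc (suc i))) = sym (swap-wkwk (ρ (bd i)))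
swap-ext ρ (fr a) = sym (swap-wkwk (ρ (fr a)))

rename-≡ₛ : {P Q : Proc m n} → P ≡ₛ Q → (ρ : Nm n → Nm j) → rename ρ P ≡ₛ rename ρ Q
rename-≡ₛ refl≡ ρ = refl≡
rename-≡ₛ (sym≡ e) ρ = sym≡ (rename-≡ₛ e ρ)
rename-≡ₛ (trans≡ e f) ρ = trans≡ (rename-≡ₛ e ρ) (rename-≡ₛ f ρ)
rename-≡ₛ (c-inp e) ρ = c-inp (rename-≡ₛ e (ext ρ))
rename-≡ₛ (c-out e) ρ = c-out (rename-≡ₛ e ρ)
rename-≡ₛ (c-tau e) ρ = c-tau (rename-≡ₛ e ρ)
rename-≡ₛ (c-mat e) ρ = c-mat (rename-≡ₛ e ρ)
rename-≡ₛ (c-sumˡ e) ρ = c-sumˡ (rename-≡ₛ e ρ)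
rename-≡ₛ (c-sumʳ e) ρ = c-sumʳ (rename-≡ₛ e ρ)
rename-≡ₛ (c-parˡ e) ρ = c-parˡ (rename-≡ₛ e ρ)
rename-≡ₛ (c-parʳ e) ρ = c-parʳ (rename-≡ₛ e ρ)
rename-≡ₛ (c-new e) ρ = c-new (rename-≡ₛ e (ext ρ))
rename-≡ₛ (c-bang e) ρ = c-bang (rename-≡ₛ e ρ)
rename-≡ₛ par-unit ρ = par-unit
rename-≡ₛ par-comm ρ = par-comm
rename-≡ₛ par-assoc ρ = par-assoc
rename-≡ₛ sum-unit ρ = sum-unit
rename-≡ₛ sum-comm ρ = sum-comm
rename-≡ₛ sum-assoc ρ = sum-assoc
rename-≡ₛ new-nil ρ = new-nil
rename-≡ₛ (new-swap {P = P}) ρ =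
  subst (λ R → new (new (rename (ext (ext ρ)) P)) ≡ₛ new (new R))
    (sym (rename-square (swap-ext ρ) P)) new-swap
rename-≡ₛ (new-par {P = P} {Q}) ρ =
  subst (λ R → new (R ∥ rename (ext ρ) Q) ≡ₛ rename ρ P ∥ new (rename (ext ρ) Q))
    (sym (rename-wk ρ P)) new-par
rename-≡ₛ bang-unf ρ = bang-unf
rename-≡ₛ mat-refl ρ = mat-refl

inp-inj : {x y : Nm n} {P Q : Proc m (suc n)} → inp x P ≡ inp y Q → x ≡ y × P ≡ Q
inp-inj refl = refl , refl

out-inj : {x x' y y' : Nm n} {P Q : Proc m n} → out x y P ≡ out x' y' Q →
  x ≡ x' × y ≡ y' × P ≡ Q
out-inj refl = refl , refl , refl

tau-inj : {P Q : Proc m n} → tau P ≡ tau Q → P ≡ Q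
tau-inj refl = refl

⊕-inj : {P P' Q Q' : Proc m n} → P ⊕ Q ≡ P' ⊕ Q' → P ≡ P' × Q ≡ Q'
⊕-inj refl = refl , refl

∥-inj : {P P' Q Q' : Proc m n} → P ∥ Q ≡ P' ∥ Q' → P ≡ P' × Q ≡ Q'
∥-inj refl = refl , refl

new-inj : {P Q : Proc m (suc n)} → new P ≡ new Q → P ≡ Q
new-inj refl = refl

bang-inj : {P Q : Proc m n} → bang P ≡ bang Q → P ≡ Q
bang-inj refl = refl

-- The equation rename ρ P ≡ rename θ P says that ρ and θ agree on the free
-- names of P, atoms and dangling indices alike.

ext-transfer : {ρ₁ θ₁ : Nm n → Nm j} {ρ₂ θ₂ : Nm n → Nm l} →
  (∀ x → ρ₁ x ≡ θ₁ x → ρ₂ x ≡ θ₂ x) →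
  ∀ x → ext ρ₁ x ≡ ext θ₁ x → ext ρ₂ x ≡ ext θ₂ x
ext-transfer h (bd zero) e = refl
ext-transfer h (bd (suc i)) e = cong wkN (h (bd i) (wkN-inj e))
ext-transfer h (fr a) e = cong wkN (h (fr a) (wkN-inj e))

-- An equation between two renamings of P splits into equations at the name occurrences of P, so a
-- pointwise implication lifts.
agree-transfer : {ρ₁ θ₁ : Nm n → Nm j} {ρ₂ θ₂ : Nm n → Nm l} →
  (∀ x → ρ₁ x ≡ θ₁ x → ρ₂ x ≡ θ₂ x) → (P : Proc false n) →
  rename ρ₁ P ≡ rename θ₁ P → rename ρ₂ P ≡ rename θ₂ P
agree-transfer h nil e = refl
agree-transfer h (inp x P) e with inp-inj e
... | ex , eP = cong₂ inp (h x ex) (agree-transfer (ext-transfer h) P eP)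
agree-transfer h (out x y P) e with out-inj e
... | ex , ey , eP = cong₃ out (h x ex) (h y ey) (agree-transfer h P eP)
agree-transfer h (tau P) e = cong tau (agree-transfer h P (tau-inj e))
agree-transfer h (P ⊕ Q) e with ⊕-inj e
... | eP , eQ = cong₂ _⊕_ (agree-transfer h P eP) (agree-transfer h Q eQ)
agree-transfer h (P ∥ Q) e with ∥-inj e
... | eP , eQ = cong₂ _∥_ (agree-transfer h P eP) (agree-transfer h Q eQ)
agree-transfer h (new P) e = cong new (agree-transfer (ext-transfer h) P (new-inj e))
agree-transfer h (bang P) e = cong bang (agree-transfer h P (bang-inj e))
agree-transfer h ok e = refl

Agree : (ρ θ : Nm n → Nm j) → Proc false n → Set
Agree ρ θ P = rename ρ P ≡ rename θ P

⇔-refl : ∀ {A : Set} → A ⇔ A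
⇔-refl = ⇔-id _

⇔-trans : ∀ {A B C : Set} → A ⇔ B → B ⇔ C → A ⇔ C
⇔-trans e f = f ⇔-∘ e

-- Without match both sides of every law have the same free names; `mat-refl` would erase one.
agree-≡ₛ : {P Q : Proc false n} → P ≡ₛ Q → {ρ θ : Nm n → Nm j} → Agree ρ θ P ⇔ Agree ρ θ Q
agree-≡ₛ refl≡ = ⇔-refl
agree-≡ₛ (sym≡ e) = ⇔-sym (agree-≡ₛ e)
agree-≡ₛ (trans≡ e f) = ⇔-trans (agree-≡ₛ e) (agree-≡ₛ f)
agree-≡ₛ (c-inp e) =
  mk⇔ (λ q → let (a , b) = inp-inj q in cong₂ inp a (Equivalence.to (agree-≡ₛ e) b))
      (λ q → let (a , b) = inp-inj q in cong₂ inp a (Equivalence.from (agree-≡ₛ e) b))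
agree-≡ₛ (c-out e) =
  mk⇔ (λ q → let (a , b , c) = out-inj q in cong₃ out a b (Equivalence.to (agree-≡ₛ e) c))
      (λ q → let (a , b , c) = out-inj q in cong₃ out a b (Equivalence.from (agree-≡ₛ e) c))
agree-≡ₛ (c-tau e) =
  mk⇔ (cong tau ∘ Equivalence.to (agree-≡ₛ e) ∘ tau-inj)
      (cong tau ∘ Equivalence.from (agree-≡ₛ e) ∘ tau-inj)
agree-≡ₛ (c-mat {t = ()} e)
agree-≡ₛ (c-sumˡ e) =
  mk⇔ (λ q → let (a , b) = ⊕-inj q in cong₂ _⊕_ (Equivalence.to (agree-≡ₛ e) a) b)
      (λ q → let (a , b) = ⊕-inj q in cong₂ _⊕_ (Equivalence.from (agree-≡ₛ e) a) b)
agree-≡ₛ (c-sumʳ e) =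
  mk⇔ (λ q → let (a , b) = ⊕-inj q in cong₂ _⊕_ a (Equivalence.to (agree-≡ₛ e) b))
      (λ q → let (a , b) = ⊕-inj q in cong₂ _⊕_ a (Equivalence.from (agree-≡ₛ e) b))
agree-≡ₛ (c-parˡ e) =
  mk⇔ (λ q → let (a , b) = ∥-inj q in cong₂ _∥_ (Equivalence.to (agree-≡ₛ e) a) b)
      (λ q → let (a , b) = ∥-inj q in cong₂ _∥_ (Equivalence.from (agree-≡ₛ e) a) b)
agree-≡ₛ (c-parʳ e) =
  mk⇔ (λ q → let (a , b) = ∥-inj q in cong₂ _∥_ a (Equivalence.to (agree-≡ₛ e) b))
      (λ q → let (a , b) = ∥-inj q in cong₂ _∥_ a (Equivalence.from (agree-≡ₛ e) b))
agree-≡ₛ (c-new e) =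
  mk⇔ (cong new ∘ Equivalence.to (agree-≡ₛ e) ∘ new-inj)
      (cong new ∘ Equivalence.from (agree-≡ₛ e) ∘ new-inj)
agree-≡ₛ (c-bang e) =
  mk⇔ (cong bang ∘ Equivalence.to (agree-≡ₛ e) ∘ bang-inj)
      (cong bang ∘ Equivalence.from (agree-≡ₛ e) ∘ bang-inj)
agree-≡ₛ par-unit = mk⇔ (proj₁ ∘ ∥-inj) (cong (_∥ nil))
agree-≡ₛ par-comm =
  mk⇔ (λ q → let (a , b) = ∥-inj q in cong₂ _∥_ b a)
      (λ q → let (a , b) = ∥-inj q in cong₂ _∥_ b a)
agree-≡ₛ par-assoc =
  mk⇔ (λ q → let (ab , c) = ∥-inj q ; (a , b) = ∥-inj ab in cong₂ _∥_ a (cong₂ _∥_ b c))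
      (λ q → let (a , bc) = ∥-inj q ; (b , c) = ∥-inj bc in cong₂ _∥_ (cong₂ _∥_ a b) c)
agree-≡ₛ sum-unit = mk⇔ (proj₁ ∘ ⊕-inj) (cong (_⊕ nil))
agree-≡ₛ sum-comm =
  mk⇔ (λ q → let (a , b) = ⊕-inj q in cong₂ _⊕_ b a)
      (λ q → let (a , b) = ⊕-inj q in cong₂ _⊕_ b a)
agree-≡ₛ sum-assoc =
  mk⇔ (λ q → let (ab , c) = ⊕-inj q ; (a , b) = ⊕-inj ab in cong₂ _⊕_ a (cong₂ _⊕_ b c))
      (λ q → let (a , bc) = ⊕-inj q ; (b , c) = ⊕-inj bc in cong₂ _⊕_ (cong₂ _⊕_ a b) c)
agree-≡ₛ new-nil = mk⇔ (λ _ → refl) (λ _ → refl)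
agree-≡ₛ (new-swap {P = P}) {ρ} {θ} =
  mk⇔ (λ q → cong (λ (R : Proc false _) → Proc.new (Proc.new R))
        (trans (swapped ρ P) (trans (cong (rename swapN) (new-inj (new-inj q))) (sym (swapped θ P)))))
      (λ q → cong (λ (R : Proc false _) → Proc.new (Proc.new R))
        (trans (sym (back ρ)) (trans (cong (rename swapN) (new-inj (new-inj q))) (back θ))))
  where
  swapped : (ρ : Nm n → Nm j) (P : Proc false (suc (suc n))) →
    rename (ext (ext ρ)) (rename swapN P) ≡ rename swapN (rename (ext (ext ρ)) P)
  swapped ρ = rename-square (swap-ext ρ)

  back : (ρ : Nm _ → Nm _) →
    rename swapN (rename (ext (ext ρ)) (rename swapN P)) ≡ rename (ext (ext ρ)) P
  back ρ = trans (cong (rename swapN) (swapped ρ P))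
    (trans (rename-∘ swap-swap (rename (ext (ext ρ)) P)) (rename-id (λ _ → refl) _))
agree-≡ₛ (new-par {P = P}) {ρ} {θ} =
  mk⇔ (λ q → let (a , b) = ∥-inj (new-inj q) in
        cong₂ (λ A B → A ∥ new B)
          (wk-injective (trans (sym (rename-wk ρ P)) (trans a (rename-wk θ P)))) b)
      (λ q → let (a , b) = ∥-inj q in
        cong₂ (λ A B → new (A ∥ B))
          (trans (rename-wk ρ P) (trans (cong wk a) (sym (rename-wk θ P)))) (new-inj b))
agree-≡ₛ bang-unf = mk⇔ (λ q → cong₂ _∥_ (bang-inj q) q) (proj₂ ∘ ∥-inj)
agree-≡ₛ (mat-refl {t = ()})

-- Fixes every name except `bd zero`, so agreement with `id` expresses that the innermost bound name
-- is absent. The value `fr 0` is a dummy.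
resetN : Nm (suc n) → Nm (suc n)
resetN = wkN ∘ sub0N (fr 0)

reset-wk : (P : Proc false n) → Agree id resetN (wk P)
reset-wk = rename-square (λ x → sym (cong wkN (sub0-wk (fr 0) x)))

unreset : (P : Proc false (suc n)) → Agree id resetN P → P ≡ wk (P [ fr 0 ])
unreset P e = trans (sym (rename-id (λ _ → refl) P))
  (trans e (sym (rename-∘ (λ _ → refl) P)))

wk-≡ₛ : {P : Proc false n} {Q : Proc false (suc n)} → wk P ≡ₛ Q → Q ≡ wk (Q [ fr 0 ])
wk-≡ₛ {P = P} {Q} e = unreset Q (Equivalence.to (agree-≡ₛ e) (reset-wk P))

-- `ext ρ` fixes `bd zero`, so a bound name that is absent after the renaming was absent before.
-- This reflects vacuous restrictions.
unrename-wk : (ρ : Nm n → Nm j) (P : Proc false (suc n)) {Q : Proc false j} →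
  rename (ext ρ) P ≡ wk Q → P ≡ wk (P [ fr 0 ]) × Q ≡ rename ρ (P [ fr 0 ])
unrename-wk ρ P {Q} e = p , wk-injective (trans (sym e)
    (trans (cong (rename (ext ρ)) p) (rename-wk ρ (P [ fr 0 ]))))
  where
  names : ∀ x → id (ext ρ x) ≡ resetN (ext ρ x) → id x ≡ resetN x
  names (bd zero) ()
  names (bd (suc i)) _ = refl
  names (fr a) _ = refl

  p : P ≡ wk (P [ fr 0 ])
  p = unreset P (agree-transfer names P
    (trans (sym (rename-∘ (λ _ → refl) P))
      (trans (subst (Agree id resetN) (sym e) (reset-wk Q)) (rename-∘ (λ _ → refl) P))))

-- Inert terms and offered prefixes

-- Inert terms are those that `≡ₛ` can erase. A replication is active even if its body is inert,
-- since it can be unfolded but never removed.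
Act : Proc false n → Set
Act nil = ⊥
Act (inp _ _) = ⊤
Act (out _ _ _) = ⊤
Act (tau _) = ⊤
Act (P ⊕ Q) = Act P ⊎ Act Q
Act (P ∥ Q) = Act P ⊎ Act Q
Act (new P) = Act P
Act (bang P) = ⊤
Act ok = ⊤

Inert : Proc false n → Set
Inert P = ¬ Act P

⊎-unit : ∀ {A : Set} → (A ⊎ ⊥) ⇔ A
⊎-unit = mk⇔ [ id , (λ ()) ]′ inj₁

⊎-comm⇔ : ∀ {A B : Set} → (A ⊎ B) ⇔ (B ⊎ A)
⊎-comm⇔ = mk⇔ Sum.swap Sum.swap

⊎-assoc⇔ : ∀ {A B C : Set} → ((A ⊎ B) ⊎ C) ⇔ (A ⊎ (B ⊎ C))
⊎-assoc⇔ = mk⇔ Sum.assocʳ Sum.assocˡ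

Act-rename : (ρ : Nm n → Nm j) (P : Proc false n) → Act (rename ρ P) ⇔ Act P
Act-rename ρ nil = ⇔-refl
Act-rename ρ (inp _ _) = ⇔-refl
Act-rename ρ (out _ _ _) = ⇔-refl
Act-rename ρ (tau _) = ⇔-refl
Act-rename ρ (P ⊕ Q) = ⊎-⇔ (Act-rename ρ P) (Act-rename ρ Q)
Act-rename ρ (P ∥ Q) = ⊎-⇔ (Act-rename ρ P) (Act-rename ρ Q)
Act-rename ρ (new P) = Act-rename (ext ρ) P
Act-rename ρ (bang P) = ⇔-refl
Act-rename ρ ok = ⇔-refl

inert-rename : (ρ : Nm n → Nm j) {P : Proc false n} → Inert P → Inert (rename ρ P)
inert-rename ρ {P} i = i ∘ Equivalence.to (Act-rename ρ P)

Ok-rename : (ρ : Nm n → Nm j) (P : Proc false n) → Unguarded✓ (rename ρ P) ⇔ Unguarded✓ P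
Ok-rename ρ nil = ⇔-refl
Ok-rename ρ (inp _ _) = ⇔-refl
Ok-rename ρ (out _ _ _) = ⇔-refl
Ok-rename ρ (tau _) = ⇔-refl
Ok-rename ρ (P ⊕ Q) = ⊎-⇔ (Ok-rename ρ P) (Ok-rename ρ Q)
Ok-rename ρ (P ∥ Q) = ⊎-⇔ (Ok-rename ρ P) (Ok-rename ρ Q)
Ok-rename ρ (new P) = Ok-rename (ext ρ) P
Ok-rename ρ (bang P) = Ok-rename ρ P
Ok-rename ρ ok = ⇔-refl

Act-≡ₛ : {P Q : Proc false n} → P ≡ₛ Q → Act P ⇔ Act Q
Act-≡ₛ refl≡ = ⇔-refl
Act-≡ₛ (sym≡ e) = ⇔-sym (Act-≡ₛ e)
Act-≡ₛ (trans≡ e f) = ⇔-trans (Act-≡ₛ e) (Act-≡ₛ f)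
Act-≡ₛ (c-inp e) = ⇔-refl
Act-≡ₛ (c-out e) = ⇔-refl
Act-≡ₛ (c-tau e) = ⇔-refl
Act-≡ₛ (c-mat {t = ()} e)
Act-≡ₛ (c-sumˡ e) = ⊎-⇔ (Act-≡ₛ e) ⇔-refl
Act-≡ₛ (c-sumʳ e) = ⊎-⇔ ⇔-refl (Act-≡ₛ e)
Act-≡ₛ (c-parˡ e) = ⊎-⇔ (Act-≡ₛ e) ⇔-refl
Act-≡ₛ (c-parʳ e) = ⊎-⇔ ⇔-refl (Act-≡ₛ e)
Act-≡ₛ (c-new e) = Act-≡ₛ e
Act-≡ₛ (c-bang e) = ⇔-refl
Act-≡ₛ par-unit = ⊎-unit
Act-≡ₛ par-comm = ⊎-comm⇔
Act-≡ₛ par-assoc = ⊎-assoc⇔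
Act-≡ₛ sum-unit = ⊎-unit
Act-≡ₛ sum-comm = ⊎-comm⇔
Act-≡ₛ sum-assoc = ⊎-assoc⇔
Act-≡ₛ new-nil = ⇔-refl
Act-≡ₛ (new-swap {P = P}) = ⇔-sym (Act-rename swapN P)
Act-≡ₛ (new-par {P = P}) = ⊎-⇔ (Act-rename wkN P) ⇔-refl
Act-≡ₛ bang-unf = mk⇔ (λ _ → inj₂ tt) (λ _ → tt)
Act-≡ₛ (mat-refl {t = ()})

inert-≡ₛ : {P Q : Proc false n} → P ≡ₛ Q → Inert P → Inert Q
inert-≡ₛ e i = i ∘ Equivalence.from (Act-≡ₛ e)

Ok-≡ₛ : {P Q : Proc false n} → P ≡ₛ Q → Unguarded✓ P ⇔ Unguarded✓ Q
Ok-≡ₛ refl≡ = ⇔-refl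
Ok-≡ₛ (sym≡ e) = ⇔-sym (Ok-≡ₛ e)
Ok-≡ₛ (trans≡ e f) = ⇔-trans (Ok-≡ₛ e) (Ok-≡ₛ f)
Ok-≡ₛ (c-inp e) = ⇔-refl
Ok-≡ₛ (c-out e) = ⇔-refl
Ok-≡ₛ (c-tau e) = ⇔-refl
Ok-≡ₛ (c-mat {t = ()} e)
Ok-≡ₛ (c-sumˡ e) = ⊎-⇔ (Ok-≡ₛ e) ⇔-refl
Ok-≡ₛ (c-sumʳ e) = ⊎-⇔ ⇔-refl (Ok-≡ₛ e)
Ok-≡ₛ (c-parˡ e) = ⊎-⇔ (Ok-≡ₛ e) ⇔-refl
Ok-≡ₛ (c-parʳ e) = ⊎-⇔ ⇔-refl (Ok-≡ₛ e)
Ok-≡ₛ (c-new e) = Ok-≡ₛ e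
Ok-≡ₛ (c-bang e) = Ok-≡ₛ e
Ok-≡ₛ par-unit = ⊎-unit
Ok-≡ₛ par-comm = ⊎-comm⇔
Ok-≡ₛ par-assoc = ⊎-assoc⇔
Ok-≡ₛ sum-unit = ⊎-unit
Ok-≡ₛ sum-comm = ⊎-comm⇔
Ok-≡ₛ sum-assoc = ⊎-assoc⇔
Ok-≡ₛ new-nil = ⇔-refl
Ok-≡ₛ (new-swap {P = P}) = ⇔-sym (Ok-rename swapN P)
Ok-≡ₛ (new-par {P = P}) = ⊎-⇔ (Ok-rename wkN P) ⇔-refl
Ok-≡ₛ bang-unf = mk⇔ inj₁ [ id , id ]′
Ok-≡ₛ (mat-refl {t = ()})

inert-≡nil : (P : Proc false n) → Inert P → P ≡ₛ nil
inert-≡nil nil i = refl≡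
inert-≡nil (inp _ _) i = ⊥-elim (i tt)
inert-≡nil (out _ _ _) i = ⊥-elim (i tt)
inert-≡nil (tau _) i = ⊥-elim (i tt)
inert-≡nil (P ⊕ Q) i = trans≡ (c-sumʳ (inert-≡nil Q (i ∘ inj₂)))
  (trans≡ sum-unit (inert-≡nil P (i ∘ inj₁)))
inert-≡nil (P ∥ Q) i = trans≡ (c-parʳ (inert-≡nil Q (i ∘ inj₂)))
  (trans≡ par-unit (inert-≡nil P (i ∘ inj₁)))
inert-≡nil (new P) i = trans≡ (c-new (inert-≡nil P i)) new-nil
inert-≡nil (bang P) i = ⊥-elim (i tt)
inert-≡nil ok i = ⊥-elim (i tt)

inert-agree : (P : Proc false n) → Inert P → {ρ θ : Nm n → Nm j} → Agree ρ θ P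
inert-agree P i = Equivalence.from (agree-≡ₛ (inert-≡nil P i)) refl

data Pre (n : ℕ) : Set where
  tauP : Proc false n → Pre n
  inpP : Nm n → Proc false (suc n) → Pre n
  outP : Nm n → Nm n → Proc false n → Pre n

prefix : Pre n → Proc false n
prefix (tauP P) = tau P
prefix (inpP x P) = inp x P
prefix (outP x y P) = out x y P

renameP : (Nm n → Nm j) → Pre n → Pre j
renameP ρ (tauP P) = tauP (rename ρ P)
renameP ρ (inpP x P) = inpP (ρ x) (rename (ext ρ) P)
renameP ρ (outP x y P) = outP (ρ x) (ρ y) (rename ρ P)

-- P ↘ π characterises P ≡ₛ prefix π ⊕ M without mentioning ≡ₛ: a parallel
-- composition offers a summand only if its other component is inert, and a
-- restriction only if its name does not occur.

infix 4 _↘_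
data _↘_ : Proc false n → Pre n → Set where
  o-tau  : {P : Proc false n} → tau P ↘ tauP P
  o-inp  : {x : Nm n} {P : Proc false (suc n)} → inp x P ↘ inpP x P
  o-out  : {x y : Nm n} {P : Proc false n} → out x y P ↘ outP x y P
  o-sumˡ : {P Q : Proc false n} {π : Pre n} → P ↘ π → P ⊕ Q ↘ π
  o-sumʳ : {P Q : Proc false n} {π : Pre n} → Q ↘ π → P ⊕ Q ↘ π
  o-parˡ : {P Q : Proc false n} {π : Pre n} → P ↘ π → Inert Q → P ∥ Q ↘ π
  o-parʳ : {P Q : Proc false n} {π : Pre n} → Q ↘ π → Inert P → P ∥ Q ↘ π
  o-new  : {P : Proc false (suc n)} {P₀ : Proc false n} {π : Pre n} →
           P ≡ wk P₀ → P₀ ↘ π → new P ↘ π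

↘-rename : (ρ : Nm n → Nm j) {P : Proc false n} {π : Pre n} → P ↘ π → rename ρ P ↘ renameP ρ π
↘-rename ρ o-tau = o-tau
↘-rename ρ o-inp = o-inp
↘-rename ρ o-out = o-out
↘-rename ρ (o-sumˡ o) = o-sumˡ (↘-rename ρ o)
↘-rename ρ (o-sumʳ o) = o-sumʳ (↘-rename ρ o)
↘-rename ρ (o-parˡ {Q = Q} o i) = o-parˡ (↘-rename ρ o) (inert-rename ρ {Q} i)
↘-rename ρ (o-parʳ {P = P} o i) = o-parʳ (↘-rename ρ o) (inert-rename ρ {P} i)
↘-rename ρ (o-new {P₀ = P₀} refl o) = o-new (rename-wk ρ P₀) (↘-rename ρ o)

-- Only the existence of an offer is reflected. That suffices to show that a term offering nothing
-- still offers nothing after a renaming.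
↘-unrename : (ρ : Nm n → Nm j) (P : Proc false n) {π : Pre j} →
  rename ρ P ↘ π → ∃[ π₀ ] P ↘ π₀
↘-unrename ρ (inp x P) o = _ , o-inp
↘-unrename ρ (out x y P) o = _ , o-out
↘-unrename ρ (tau P) o = _ , o-tau
↘-unrename ρ (P ⊕ Q) (o-sumˡ o) with ↘-unrename ρ P o
... | _ , o' = _ , o-sumˡ o'
↘-unrename ρ (P ⊕ Q) (o-sumʳ o) with ↘-unrename ρ Q o
... | _ , o' = _ , o-sumʳ o'
↘-unrename ρ (P ∥ Q) (o-parˡ o i) with ↘-unrename ρ P o
... | _ , o' = _ , o-parˡ o' (i ∘ Equivalence.from (Act-rename ρ Q))
↘-unrename ρ (P ∥ Q) (o-parʳ o i) with ↘-unrename ρ Q o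
... | _ , o' = _ , o-parʳ o' (i ∘ Equivalence.from (Act-rename ρ P))
↘-unrename ρ (new P) (o-new e o) with unrename-wk ρ P e
... | p , refl with ↘-unrename ρ (P [ fr 0 ]) o
...   | _ , o' = _ , o-new p o'

↘-act : {P : Proc false n} {π : Pre n} → P ↘ π → Act P
↘-act o-tau = tt
↘-act o-inp = tt
↘-act o-out = tt
↘-act (o-sumˡ o) = inj₁ (↘-act o)
↘-act (o-sumʳ o) = inj₂ (↘-act o)
↘-act (o-parˡ o _) = inj₁ (↘-act o)
↘-act (o-parʳ o _) = inj₂ (↘-act o)
↘-act (o-new {P₀ = P₀} refl o) = Equivalence.from (Act-rename wkN P₀) (↘-act o)

-- Invariance of offers under structural congruence

infix 4 _≈_
data _≈_ {n : ℕ} : Pre n → Pre n → Set where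
  ≈-tau : {P Q : Proc false n} → P ≡ₛ Q → tauP P ≈ tauP Q
  ≈-inp : {x : Nm n} {P Q : Proc false (suc n)} → P ≡ₛ Q → inpP x P ≈ inpP x Q
  ≈-out : {x y : Nm n} {P Q : Proc false n} → P ≡ₛ Q → outP x y P ≈ outP x y Q

≈-refl : {π : Pre n} → π ≈ π
≈-refl {π = tauP _} = ≈-tau refl≡
≈-refl {π = inpP _ _} = ≈-inp refl≡
≈-refl {π = outP _ _ _} = ≈-out refl≡

≈-trans : {π₁ π₂ π₃ : Pre n} → π₁ ≈ π₂ → π₂ ≈ π₃ → π₁ ≈ π₃
≈-trans (≈-tau e) (≈-tau f) = ≈-tau (trans≡ e f)
≈-trans (≈-inp e) (≈-inp f) = ≈-inp (trans≡ e f)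
≈-trans (≈-out e) (≈-out f) = ≈-out (trans≡ e f)

≈-rename : {π₁ π₂ : Pre n} (ρ : Nm n → Nm j) → π₁ ≈ π₂ → renameP ρ π₁ ≈ renameP ρ π₂
≈-rename ρ (≈-tau e) = ≈-tau (rename-≡ₛ e ρ)
≈-rename ρ (≈-inp e) = ≈-inp (rename-≡ₛ e _)
≈-rename ρ (≈-out e) = ≈-out (rename-≡ₛ e ρ)

infix 4 _⊑ₒ_
_⊑ₒ_ : Proc false n → Proc false n → Set
P ⊑ₒ Q = ∀ {π} → P ↘ π → ∃[ π' ] (Q ↘ π' × π ≈ π')

same : {P Q : Proc false n} → (∀ {π} → P ↘ π → Q ↘ π) → P ⊑ₒ Q
same f o = _ , f o , ≈-refl

-- `wk-≡ₛ` carries the absence of the bound name along the congruence; instantiating the absent name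
-- then brings the offer back to the outer scope.
⊑ₒ-new : {P Q : Proc false (suc n)} → P ≡ₛ Q → P ⊑ₒ Q → new P ⊑ₒ new Q
⊑ₒ-new {Q = Q} e h (o-new {P₀ = P₀} refl o) with h (↘-rename wkN o) | wk-≡ₛ e
... | π' , o' , c | q with ↘-rename (sub0N (fr 0)) o'
...   | o'' = _ , o-new q o'' , subst (_≈ _) (renameP-wk-[] _) (≈-rename (sub0N (fr 0)) c)
  where
  renameP-wk-[] : (π : Pre n) → renameP (sub0N (fr 0)) (renameP wkN π) ≡ π
  renameP-wk-[] (tauP P) = cong tauP (wk-[] P (fr 0))
  renameP-wk-[] (inpP x P) = cong₂ inpP (sub0-wk (fr 0) x)
    (trans (rename-∘ (ext-∘ (sub0-wk (fr 0))) P) (rename-id (ext-id (λ _ → refl)) P))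
  renameP-wk-[] (outP x y P) = cong₃ outP (sub0-wk (fr 0) x) (sub0-wk (fr 0) y) (wk-[] P (fr 0))

new-swap-↘ : {P : Proc false (suc (suc n))} {π : Pre n} →
  new (new P) ↘ π → new (new (rename swapN P)) ↘ π
new-swap-↘ {P = P} (o-new {P₀ = new P₁} e (o-new {P₀ = P₂} refl o)) =
  o-new {P₀ = new (wk P₂)}
    (cong new (trans (cong (rename swapN) (new-inj e))
      (trans (rename-∘ swap-extwk (wk P₂)) (sym (rename-wk wkN P₂)))))
    (o-new refl o)

-- Both directions are proved together because `sym≡` exchanges them. The side conditions on
-- parallel components survive since inertness is itself invariant.
⊑ₒ-≡ₛ : {P Q : Proc false n} → P ≡ₛ Q → (P ⊑ₒ Q) × (Q ⊑ₒ P)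
⊑ₒ-≡ₛ refl≡ = same id , same id
⊑ₒ-≡ₛ (sym≡ e) = proj₂ (⊑ₒ-≡ₛ e) , proj₁ (⊑ₒ-≡ₛ e)
⊑ₒ-≡ₛ (trans≡ {P = P} {Q} {R} e f) =
  comp {P} {Q} {R} (proj₁ (⊑ₒ-≡ₛ e)) (proj₁ (⊑ₒ-≡ₛ f)) , comp {R} {Q} {P} (proj₂ (⊑ₒ-≡ₛ f)) (proj₂ (⊑ₒ-≡ₛ e))
  where
  comp : ∀ {P Q R} → P ⊑ₒ Q → Q ⊑ₒ R → P ⊑ₒ R
  comp g h o with g o
  ... | _ , o' , c with h o'
  ...   | _ , o'' , c' = _ , o'' , ≈-trans c c'
⊑ₒ-≡ₛ (c-inp e) = (λ { o-inp → _ , o-inp , ≈-inp e }) , (λ { o-inp → _ , o-inp , ≈-inp (sym≡ e) })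
⊑ₒ-≡ₛ (c-out e) = (λ { o-out → _ , o-out , ≈-out e }) , (λ { o-out → _ , o-out , ≈-out (sym≡ e) })
⊑ₒ-≡ₛ (c-tau e) = (λ { o-tau → _ , o-tau , ≈-tau e }) , (λ { o-tau → _ , o-tau , ≈-tau (sym≡ e) })
⊑ₒ-≡ₛ (c-mat {t = ()} e)
⊑ₒ-≡ₛ (c-sumˡ {P = P} {Q} {R} e) = side {P} {Q} (proj₁ (⊑ₒ-≡ₛ e)) , side {Q} {P} (proj₂ (⊑ₒ-≡ₛ e))
  where
  side : ∀ {P Q} → P ⊑ₒ Q → P ⊕ R ⊑ₒ Q ⊕ R
  side h (o-sumˡ o) = let (_ , o' , c) = h o in _ , o-sumˡ o' , c
  side h (o-sumʳ o) = _ , o-sumʳ o , ≈-refl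
⊑ₒ-≡ₛ (c-sumʳ {P = P} {Q} {R} e) = side {P} {Q} (proj₁ (⊑ₒ-≡ₛ e)) , side {Q} {P} (proj₂ (⊑ₒ-≡ₛ e))
  where
  side : ∀ {P Q} → P ⊑ₒ Q → R ⊕ P ⊑ₒ R ⊕ Q
  side h (o-sumʳ o) = let (_ , o' , c) = h o in _ , o-sumʳ o' , c
  side h (o-sumˡ o) = _ , o-sumˡ o , ≈-refl
⊑ₒ-≡ₛ (c-parˡ {P = P} {Q} {R} e) =
  side e (proj₁ (⊑ₒ-≡ₛ e)) , side (sym≡ e) (proj₂ (⊑ₒ-≡ₛ e))
  where
  side : ∀ {P Q} → P ≡ₛ Q → P ⊑ₒ Q → P ∥ R ⊑ₒ Q ∥ R
  side e h (o-parˡ o i) = let (_ , o' , c) = h o in _ , o-parˡ o' i , c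
  side e h (o-parʳ o i) = _ , o-parʳ o (inert-≡ₛ e i) , ≈-refl
⊑ₒ-≡ₛ (c-parʳ {P = P} {Q} {R} e) =
  side e (proj₁ (⊑ₒ-≡ₛ e)) , side (sym≡ e) (proj₂ (⊑ₒ-≡ₛ e))
  where
  side : ∀ {P Q} → P ≡ₛ Q → P ⊑ₒ Q → R ∥ P ⊑ₒ R ∥ Q
  side e h (o-parʳ o i) = let (_ , o' , c) = h o in _ , o-parʳ o' i , c
  side e h (o-parˡ o i) = _ , o-parˡ o (inert-≡ₛ e i) , ≈-refl
⊑ₒ-≡ₛ (c-new e) = ⊑ₒ-new e (proj₁ (⊑ₒ-≡ₛ e)) , ⊑ₒ-new (sym≡ e) (proj₂ (⊑ₒ-≡ₛ e))
⊑ₒ-≡ₛ (c-bang e) = (λ ()) , (λ ())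
⊑ₒ-≡ₛ par-unit = same (λ { (o-parˡ o _) → o }) , same (λ o → o-parˡ o id)
⊑ₒ-≡ₛ par-comm = same swap , same swap
  where
  swap : ∀ {P Q π} → P ∥ Q ↘ π → Q ∥ P ↘ π
  swap (o-parˡ o i) = o-parʳ o i
  swap (o-parʳ o i) = o-parˡ o i
⊑ₒ-≡ₛ par-assoc =
  same (λ { (o-parˡ (o-parˡ o i) j) → o-parˡ o [ i , j ]′
          ; (o-parˡ (o-parʳ o i) j) → o-parʳ (o-parˡ o j) i
          ; (o-parʳ o i) → o-parʳ (o-parʳ o (i ∘ inj₂)) (i ∘ inj₁) }) ,
  same (λ { (o-parˡ o i) → o-parˡ (o-parˡ o (i ∘ inj₁)) (i ∘ inj₂)
          ; (o-parʳ (o-parˡ o i) j) → o-parˡ (o-parʳ o j) i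
          ; (o-parʳ (o-parʳ o i) j) → o-parʳ o [ j , i ]′ })
⊑ₒ-≡ₛ sum-unit = same (λ { (o-sumˡ o) → o }) , same o-sumˡ
⊑ₒ-≡ₛ sum-comm = same swap , same swap
  where
  swap : ∀ {P Q π} → P ⊕ Q ↘ π → Q ⊕ P ↘ π
  swap (o-sumˡ o) = o-sumʳ o
  swap (o-sumʳ o) = o-sumˡ o
⊑ₒ-≡ₛ sum-assoc =
  same (λ { (o-sumˡ (o-sumˡ o)) → o-sumˡ o
          ; (o-sumˡ (o-sumʳ o)) → o-sumʳ (o-sumˡ o)
          ; (o-sumʳ o) → o-sumʳ (o-sumʳ o) }) ,
  same (λ { (o-sumˡ o) → o-sumˡ (o-sumˡ o)
          ; (o-sumʳ (o-sumˡ o)) → o-sumˡ (o-sumʳ o)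
          ; (o-sumʳ (o-sumʳ o)) → o-sumʳ o })
⊑ₒ-≡ₛ new-nil = same (λ o → ⊥-elim (↘-act o)) , same (λ ())
⊑ₒ-≡ₛ (new-swap {P = P}) = same new-swap-↘ ,
  same (λ {π} o → subst (λ R → new (new R) ↘ π)
    (trans (rename-∘ swap-swap P) (rename-id (λ _ → refl) P)) (new-swap-↘ o))
⊑ₒ-≡ₛ (new-par {P = P} {Q}) = same to , same from
  where
  to : ∀ {π} → new (wk P ∥ Q) ↘ π → P ∥ new Q ↘ π
  to (o-new {P₀ = A ∥ B} e o) with ∥-inj e
  to (o-new {P₀ = A ∥ B} e (o-parˡ o i)) | eA , refl with wk-injective eA
  ... | refl = o-parˡ o (inert-rename wkN {B} i)
  to (o-new {P₀ = A ∥ B} e (o-parʳ o i)) | eA , refl with wk-injective eA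
  ... | refl = o-parʳ (o-new refl o) i

  from : ∀ {π} → P ∥ new Q ↘ π → new (wk P ∥ Q) ↘ π
  -- An inert Q has no names, so its restriction is vacuous.
  from (o-parˡ o i) = o-new (cong (wk P ∥_) (unreset Q (inert-agree Q i)))
    (o-parˡ o (inert-rename (sub0N (fr 0)) {Q} i))
  from (o-parʳ (o-new {P₀ = B} refl o) i) = o-new refl (o-parʳ o i)
⊑ₒ-≡ₛ bang-unf = (λ ()) , (λ { (o-parˡ o i) → ⊥-elim (i tt) })
⊑ₒ-≡ₛ (mat-refl {t = ()})

↘-sound : {P : Proc false n} {π : Pre n} → P ↘ π → ∃[ M ] P ≡ₛ prefix π ⊕ M
↘-sound o-tau = nil , sym≡ sum-unit
↘-sound o-inp = nil , sym≡ sum-unit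
↘-sound o-out = nil , sym≡ sum-unit
↘-sound (o-sumˡ o) = let (_ , e) = ↘-sound o in _ , trans≡ (c-sumˡ e) sum-assoc
↘-sound (o-sumʳ o) = let (_ , e) = ↘-sound o in
  _ , trans≡ (c-sumʳ e) (trans≡ sum-comm sum-assoc)
↘-sound (o-parˡ {Q = Q} o i) = let (_ , e) = ↘-sound o in
  _ , trans≡ (c-parʳ (inert-≡nil Q i)) (trans≡ par-unit e)
↘-sound (o-parʳ {P = P} o i) = let (_ , e) = ↘-sound o in
  _ , trans≡ (c-parˡ (inert-≡nil P i)) (trans≡ par-comm (trans≡ par-unit e))
↘-sound (o-new {P₀ = P₀} refl o) = let (_ , e) = ↘-sound o in
  _ , trans≡ (new-wk P₀) e
  where
  new-wk : (P : Proc false n) → new (wk P) ≡ₛ P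
  new-wk P = trans≡ (c-new (sym≡ par-unit)) (trans≡ new-par (trans≡ (c-parʳ new-nil) par-unit))

-- Lists up to permutation and weakening

private variable
  A : Set
  x y : A
  K L L' M M' Ys : List A

-- The position of the picked element is part of the proof, so two picks of equal threads can still
-- be told apart.
data Pick {A : Set} (x : A) : List A → List A → Set where
  hd : Pick x L (x ∷ L)
  tl : Pick x L M → Pick x (y ∷ L) (y ∷ M)

pick-compare : Pick x L M → Pick y L' M → (x ≡ y × L ≡ L') ⊎ (∃[ K ] (Pick y K L × Pick x K L'))
pick-compare hd hd = inj₁ (refl , refl)
pick-compare hd (tl q) = inj₂ (_ , q , hd)
pick-compare (tl p) hd = inj₂ (_ , hd , p)
pick-compare (tl p) (tl q) with pick-compare p q
... | inj₁ (refl , refl) = inj₁ (refl , refl)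
... | inj₂ (_ , q' , p') = inj₂ (_ , tl q' , tl p')

pick-swap : Pick x L M → Pick y K L → ∃[ K' ] (Pick y K' M × Pick x K K')
pick-swap hd q = _ , tl q , hd
pick-swap (tl p) hd = _ , hd , p
pick-swap (tl p) (tl q) with pick-swap p q
... | _ , q' , p' = _ , tl q' , tl p'

pick-map : ∀ {A B : Set} {x : A} {L M} (f : A → B) → Pick x L M → Pick (f x) (map f L) (map f M)
pick-map f hd = hd
pick-map f (tl p) = tl (pick-map f p)

pick-++ˡ : Pick x L M → Pick x (L ++ K) (M ++ K)
pick-++ˡ hd = hd
pick-++ˡ (tl p) = tl (pick-++ˡ p)

pick-++ʳ : (K : List A) → Pick x L M → Pick x (K ++ L) (K ++ M)
pick-++ʳ [] p = p
pick-++ʳ (_ ∷ K) p = tl (pick-++ʳ K p)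

infix 4 _⊑_
data _⊑_ {A : Set} : List A → List A → Set where
  []  : [] ⊑ M
  _∷_ : Pick x K M → L ⊑ K → x ∷ L ⊑ M

⊑-skip : L ⊑ M → L ⊑ y ∷ M
⊑-skip [] = []
⊑-skip (p ∷ s) = tl p ∷ ⊑-skip s

⊑-refl : L ⊑ L
⊑-refl {L = []} = []
⊑-refl {L = _ ∷ _} = hd ∷ ⊑-refl

⊑-pick : Pick x L M → M ⊑ M' → ∃[ L' ] (Pick x L' M' × L ⊑ L')
⊑-pick hd (p ∷ s) = _ , p , s
⊑-pick (tl p) (q ∷ s) with ⊑-pick p s
... | _ , p' , s' with pick-swap q p'
...   | _ , p'' , q' = _ , p'' , q' ∷ s'

⊑-map : ∀ {A B : Set} {L M : List A} (f : A → B) → L ⊑ M → map f L ⊑ map f M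
⊑-map f [] = []
⊑-map f (p ∷ s) = pick-map f p ∷ ⊑-map f s

⊑-swap : x ∷ y ∷ L ⊑ y ∷ x ∷ L
⊑-swap = tl hd ∷ ⊑-refl

⊑-++ʳ : (K : List A) → L ⊑ K ++ L
⊑-++ʳ [] = ⊑-refl
⊑-++ʳ (_ ∷ K) = ⊑-skip (⊑-++ʳ K)

⊑-front₁ : (Ys : List A) → Ys ++ x ∷ L ⊑ x ∷ Ys ++ L
⊑-front₁ [] = ⊑-refl
⊑-front₁ (_ ∷ Ys) = tl hd ∷ ⊑-front₁ Ys

⊑-front₂ : (Ys : List A) → Ys ++ x ∷ y ∷ L ⊑ x ∷ y ∷ Ys ++ L
⊑-front₂ [] = ⊑-refl
⊑-front₂ (_ ∷ Ys) = tl (tl hd) ∷ ⊑-front₂ Ys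

-- Win d M: the parallel composition of the threads M reaches success within d
-- steps.  Restrictions are opened by moving the whole list under the binder,
-- and a sum with an inert side counts as a parallel composition.

data Split {n : ℕ} : Proc false n → Proc false n → Proc false n → Set where
  s-par  : {P Q : Proc false n} → Split (P ∥ Q) P Q
  s-sum  : {P Q : Proc false n} → Inert P ⊎ Inert Q → Split (P ⊕ Q) P Q
  s-bang : {P : Proc false n} → Split (bang P) P (bang P)

private variable
  P Q R P' Q' : Proc false n
  π π' : Pre n
  X Y : Proc false n
  ι : Nm n → Nm j

data Win {n : ℕ} : ℕ → List (Proc false n) → Set where
  w-ok    : Pick P L M → Unguarded✓ P → Win d M
  w-split : Pick P L M → Split P Q R → Win d (Q ∷ R ∷ L) → Win d M
  w-new   : Pick (new P) L M → Win d (P ∷ map wk L) → Win d M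
  w-tau   : Pick P L M → P ↘ tauP R → Win d (R ∷ L) → Win (suc d) M
  w-com   : ∀ {x y P' Q'} → Pick P L M → Pick Q K L → P ↘ inpP x P' → Q ↘ outP x y Q' →
            Win d (P' [ y ] ∷ Q' ∷ K) → Win (suc d) M

win-⊑ : Win d M → M ⊑ M' → Win d M'
win-⊑ (w-ok p u) s with ⊑-pick p s
... | _ , p' , _ = w-ok p' u
win-⊑ (w-split p f w) s with ⊑-pick p s
... | _ , p' , s' = w-split p' f (win-⊑ w (hd ∷ (hd ∷ s')))
win-⊑ (w-new p w) s with ⊑-pick p s
... | _ , p' , s' = w-new p' (win-⊑ w (hd ∷ ⊑-map wk s'))
win-⊑ (w-tau p o w) s with ⊑-pick p s
... | _ , p' , s' = w-tau p' o (win-⊑ w (hd ∷ s'))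
win-⊑ (w-com p q o o' w) s with ⊑-pick p s
... | _ , p' , s' with ⊑-pick q s'
...   | _ , q' , s'' = w-com p' q' o o' (win-⊑ w (hd ∷ (hd ∷ s'')))

split-rename : (ρ : Nm n → Nm j) → Split P Q R → Split (rename ρ P) (rename ρ Q) (rename ρ R)
split-rename ρ s-par = s-par
split-rename ρ (s-sum {P = P} {Q} i) = s-sum (Sum.map (inert-rename ρ {P}) (inert-rename ρ {Q}) i)
split-rename ρ s-bang = s-bang

map-rename-wk : (ρ : Nm n → Nm j) (L : List (Proc false n)) →
  map (rename (ext ρ)) (map wk L) ≡ map wk (map (rename ρ) L)
map-rename-wk ρ [] = refl
map-rename-wk ρ (P ∷ L) = cong₂ _∷_ (rename-wk ρ P) (map-rename-wk ρ L)

map-rename-∘ : {ρ : Nm j → Nm l} {θ : Nm n → Nm j} {ζ : Nm n → Nm l} →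
  (∀ x → ρ (θ x) ≡ ζ x) → (L : List (Proc false n)) →
  map (rename ρ) (map (rename θ) L) ≡ map (rename ζ) L
map-rename-∘ h [] = refl
map-rename-∘ h (P ∷ L) = cong₂ _∷_ (rename-∘ h P) (map-rename-∘ h L)

map-rename-id : (L : List (Proc false n)) → map (rename id) L ≡ L
map-rename-id [] = refl
map-rename-id (P ∷ L) = cong₂ _∷_ (rename-id (λ _ → refl) P) (map-rename-id L)

win-rename : (ρ : Nm n → Nm j) → Win d M → Win d (map (rename ρ) M)
win-rename ρ (w-ok {P = P} p u) = w-ok (pick-map _ p) (Equivalence.from (Ok-rename ρ P) u)
win-rename ρ (w-split p s w) = w-split (pick-map _ p) (split-rename ρ s) (win-rename ρ w)
win-rename {d = d} ρ (w-new {P = P} {L = L} p w) = w-new (pick-map _ p)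
  (subst (λ K → Win d (rename (ext ρ) P ∷ K)) (map-rename-wk ρ L) (win-rename (ext ρ) w))
win-rename ρ (w-tau p o w) = w-tau (pick-map _ p) (↘-rename ρ o) (win-rename ρ w)
win-rename ρ (w-com {d = d} {y = y} {P' = P'} p q o o' w) =
  w-com (pick-map _ p) (pick-map _ q) (↘-rename ρ o) (↘-rename ρ o')
    (subst (λ R → Win d (R ∷ _)) (rename-[] ρ P' y) (win-rename ρ w))

-- Quantifying over the other threads, and over the received name for inputs, makes this applicable
-- whatever the communication partner was.
data Continues {n : ℕ} (d : ℕ) : Pre n → Pre n → Set where
  k-tau : (∀ {L} → Win d (P ∷ L) → Win d (Q ∷ L)) → Continues d (tauP P) (tauP Q)
  k-inp : ∀ {x P Q} → (∀ {L} y → Win d (P [ y ] ∷ L) → Win d (Q [ y ] ∷ L)) →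
          Continues d (inpP x P) (inpP x Q)
  k-out : ∀ {x y} → (∀ {L} → Win d (P ∷ L) → Win d (Q ∷ L)) →
          Continues d (outP x y P) (outP x y Q)

continues-refl : (π : Pre n) → Continues d π π
continues-refl (tauP _) = k-tau id
continues-refl (inpP _ _) = k-inp (λ _ → id)
continues-refl (outP _ _ _) = k-out id

-- Replacing a thread X by threads Ys, while the other threads are renamed
-- by ι, preserves Win d as soon as every use of X can be imitated.
record Replacement (d : ℕ) : Set₁ where
  field
    Rep : ∀ {n j} → (Nm n → Nm j) → Proc false n → List (Proc false j) → Set
    rep-wk : Rep ι X Ys → Rep (ext ι) (wk X) (map wk Ys)
    rep-ok : Rep ι X Ys → Unguarded✓ X → ∃[ Y ] ∃[ K ] (Pick Y K Ys × Unguarded✓ Y)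
    -- The functional argument is the induction hypothesis of `replace`, needed when a split exposes
    -- a replaceable thread again, as unfolding a replication does.
    rep-split : Rep ι X Ys → Split X Q R → Win d (Q ∷ R ∷ L) →
      (∀ {X' Ys' K} → Rep ι X' Ys' → Pick X' K (Q ∷ R ∷ L) → Win d (Ys' ++ map (rename ι) K)) →
      Win d (Ys ++ map (rename ι) L)
    rep-new : Rep ι (new P) Ys → Win d (P ∷ map wk L) → Win d (Ys ++ map (rename ι) L)
    rep-↘ : d ≡ suc e → Rep ι X Ys → X ↘ π →
      ∃[ Y ] ∃[ K ] ∃[ π' ] (Pick Y K Ys × Y ↘ π' × Continues e (renameP ι π) π')
    -- `Rep` may carry facts about the bound `d` alone, so after a counted step the replacement
    -- comes from an outer induction on the bound.
    rep-below : d ≡ suc e → Rep ι X Ys → Pick X L M → Win e M → Win e (Ys ++ map (rename ι) L)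

module _ {d : ℕ} (rep : Replacement d) where
  open Replacement rep

  -- Induction on the derivation: a step of other threads is repeated beside Ys, and a step of X is
  -- answered by the matching field.
  replace : Rep ι X Ys → Pick X L M → Win d M → Win d (Ys ++ map (rename ι) L)
  replace {ι = ι} {Ys = Ys} r p (w-ok {P = P} q u) with pick-compare p q
  ... | inj₁ (refl , refl) with rep-ok r u
  ...   | _ , _ , q' , u' = w-ok (pick-++ˡ q') u'
  replace {ι = ι} {Ys = Ys} r p (w-ok {P = P} q u) | inj₂ (_ , q' , p') =
    w-ok (pick-++ʳ Ys (pick-map _ q')) (Equivalence.from (Ok-rename ι P) u)
  replace {ι = ι} {Ys = Ys} r p (w-split q s w) with pick-compare p q
  ... | inj₁ (refl , refl) = rep-split r s w (λ r' p' → replace r' p' w)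
  ... | inj₂ (_ , q' , p') = w-split (pick-++ʳ Ys (pick-map _ q')) (split-rename ι s)
    (win-⊑ (replace r (tl (tl p')) w) (⊑-front₂ Ys))
  replace {ι = ι} {Ys = Ys} r p (w-new {P = P} q w) with pick-compare p q
  ... | inj₁ (refl , refl) = rep-new r w
  ... | inj₂ (K , q' , p') = w-new (pick-++ʳ Ys (pick-map _ q'))
    (subst (λ N → Win d (rename (ext ι) P ∷ N))
      (trans (cong (map wk Ys ++_) (map-rename-wk ι K)) (sym (map-++ wk Ys _)))
      (win-⊑ (replace (rep-wk r) (tl (pick-map wk p')) w) (⊑-front₁ (map wk Ys))))
  replace {ι = ι} {Ys = Ys} r p (w-tau q o w) with pick-compare p q
  replace {ι = ι} {Ys = Ys} r p (w-tau q o w) | inj₁ (refl , refl) with rep-↘ refl r o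
  ... | _ , K , _ , q' , o' , k-tau f =
    w-tau (pick-++ˡ q') o' (win-⊑ (f (win-rename ι w)) (hd ∷ ⊑-++ʳ K))
  replace {ι = ι} {Ys = Ys} r p (w-tau q o w) | inj₂ (_ , q' , p') =
    w-tau (pick-++ʳ Ys (pick-map _ q')) (↘-rename ι o)
      (win-⊑ (rep-below refl r (tl p') w) (⊑-front₁ Ys))
  replace {ι = ι} {Ys = Ys} r p (w-com {d = e} {y = y} {P' = P'} q₁ q₂ o₁ o₂ w) with pick-compare p q₁
  replace {ι = ι} {Ys = Ys} r p (w-com {d = e} {y = y} {P' = P'} q₁ q₂ o₁ o₂ w)
    | inj₁ (refl , refl) with rep-↘ refl r o₁
  ... | _ , K , _ , q' , o' , k-inp f =
    w-com (pick-++ˡ q') (pick-++ʳ K (pick-map _ q₂)) o' (↘-rename ι o₂)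
      (win-⊑ (f (ι y) (subst (λ N → Win e (N ∷ _)) (rename-[] ι P' y) (win-rename ι w)))
        (hd ∷ (hd ∷ ⊑-++ʳ K)))
  replace {ι = ι} {Ys = Ys} r p (w-com {d = e} {y = y} {P' = P'} q₁ q₂ o₁ o₂ w)
    | inj₂ (_ , q₁' , p₁) with pick-compare p₁ q₂
  ... | inj₂ (_ , q₂' , p₂) =
    w-com (pick-++ʳ Ys (pick-map _ q₁')) (pick-++ʳ Ys (pick-map _ q₂'))
      (↘-rename ι o₁) (↘-rename ι o₂)
      (win-⊑ (subst (λ N → Win e (Ys ++ N ∷ _)) (rename-[] ι P' y)
        (rep-below refl r (tl (tl p₂)) w)) (⊑-front₂ Ys))
  ... | inj₁ (refl , refl) with rep-↘ refl r o₂
  ...   | _ , K , _ , q' , o' , k-out f =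
    w-com (pick-++ʳ Ys (pick-map _ q₁')) (pick-++ˡ q') (↘-rename ι o₁) o'
      (win-⊑ (f (win-⊑ (subst (λ N → Win e (N ∷ _)) (rename-[] ι P' y) (win-rename ι w)) ⊑-swap))
        (tl hd ∷ (hd ∷ ⊑-++ʳ K)))

-- Invertibility of splitting and opening

pick-⊑ : Pick x L M → M ⊑ x ∷ L
pick-⊑ hd = ⊑-refl
pick-⊑ (tl p) = tl hd ∷ pick-⊑ p

data Elim {n j : ℕ} (ι : Nm n → Nm j) : Proc false n → List (Proc false j) → Set where
  e-split : Split P Q R → Elim ι P (rename ι Q ∷ rename ι R ∷ [])
  e-new   : (θ : Nm (suc n) → Nm j) → (∀ x → θ (wkN x) ≡ ι x) → Elim ι (new P) (rename θ P ∷ [])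
  e-nil   : Elim ι nil []

elim-wk : Elim ι X Ys → Elim (ext ι) (wk X) (map wk Ys)
elim-wk {ι = ι} (e-split {Q = Q} {R} s) =
  subst (Elim (ext ι) _) (cong₂ (λ A B → A ∷ B ∷ []) (rename-wk ι Q) (rename-wk ι R))
    (e-split (split-rename wkN s))
elim-wk {ι = ι} (e-new {P = P} θ h) =
  subst (Elim (ext ι) _) (cong (_∷ []) (rename-square θ⁺-ext P)) (e-new θ⁺ θ⁺-wk)
  where
  θ⁺ : Nm _ → Nm _
  -- Here `bd zero` is the name bound by the thread itself. The binder just opened elsewhere is
  -- `bd (suc zero)` and follows `ext ι`.
  θ⁺ (bd zero) = wkN (θ (bd zero))
  θ⁺ (bd (suc i)) = ext ι (bd i)
  θ⁺ (fr a) = ext ι (fr a)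

  θ⁺-wk : ∀ x → θ⁺ (wkN x) ≡ ext ι x
  θ⁺-wk (bd _) = refl
  θ⁺-wk (fr _) = refl

  θ⁺-ext : ∀ x → θ⁺ (ext wkN x) ≡ wkN (θ x)
  θ⁺-ext (bd zero) = refl
  θ⁺-ext (bd (suc i)) = cong wkN (sym (h (bd i)))
  θ⁺-ext (fr a) = cong wkN (sym (h (fr a)))
elim-wk e-nil = e-nil

elim-ok : Elim ι X Ys → Unguarded✓ X → ∃[ Y ] ∃[ K ] (Pick Y K Ys × Unguarded✓ Y)
elim-ok {ι = ι} (e-split s) u with split-ok s u
  where
  split-ok : Split P Q R → Unguarded✓ P → Unguarded✓ Q ⊎ Unguarded✓ R
  split-ok s-par u = u
  split-ok (s-sum _) u = u
  split-ok s-bang u = inj₁ u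
elim-ok {ι = ι} (e-split {Q = Q} s) u | inj₁ v = _ , _ , hd , Equivalence.from (Ok-rename ι Q) v
elim-ok {ι = ι} (e-split {R = R} s) u | inj₂ v = _ , _ , tl hd , Equivalence.from (Ok-rename ι R) v
elim-ok (e-new {P = P} θ h) u = _ , _ , hd , Equivalence.from (Ok-rename θ P) u

elim-↘ : Elim ι X Ys → X ↘ π →
  ∃[ Y ] ∃[ K ] ∃[ π' ] (Pick Y K Ys × Y ↘ π' × Continues e (renameP ι π) π')
elim-↘ {ι = ι} (e-split s) o with split-↘ s o
  where
  split-↘ : Split P Q R → P ↘ π → Q ↘ π ⊎ R ↘ π
  split-↘ s-par (o-parˡ o _) = inj₁ o
  split-↘ s-par (o-parʳ o _) = inj₂ o
  split-↘ (s-sum _) (o-sumˡ o) = inj₁ o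
  split-↘ (s-sum _) (o-sumʳ o) = inj₂ o
... | inj₁ o' = _ , _ , _ , hd , ↘-rename ι o' , continues-refl _
... | inj₂ o' = _ , _ , _ , tl hd , ↘-rename ι o' , continues-refl _
elim-↘ {ι = ι} (e-new θ h) (o-new {P₀ = P₀} refl o) =
  _ , _ , _ , hd , subst (_↘ _) (sym (rename-∘ h P₀)) (↘-rename ι o) , continues-refl _

elim-split : Elim ι X Ys → Split X Q R → Win d (Q ∷ R ∷ L) → Win d (Ys ++ map (rename ι) L)
elim-split {ι = ι} (e-split s-par) s-par w = win-rename ι w
elim-split {ι = ι} (e-split (s-sum _)) (s-sum _) w = win-rename ι w
elim-split {ι = ι} (e-split s-bang) s-bang w = win-rename ι w

elim-new : Elim ι (new P) Ys → Win d (P ∷ map wk L) → Win d (Ys ++ map (rename ι) L)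
elim-new {d = d} {L = L} (e-new {P = P} θ h) w =
  subst (λ N → Win d (rename θ P ∷ N)) (map-rename-∘ h L) (win-rename θ w)

elim-replacement : (∀ {e} → d ≡ suc e → ∀ {n j} {ι : Nm n → Nm j} {X Ys L M} →
  Elim ι X Ys → Pick X L M → Win e M → Win e (Ys ++ map (rename ι) L)) → Replacement d
elim-replacement below = record
  { Rep = Elim ; rep-wk = elim-wk ; rep-ok = elim-ok ; rep-split = λ r s w _ → elim-split r s w
  ; rep-new = elim-new ; rep-↘ = λ _ → elim-↘ ; rep-below = λ q → below q }

-- Whatever a thread can do, its parts can do under the same bound, so uncounted steps may be taken
-- eagerly.
win-elim : ∀ d → Elim ι X Ys → Pick X L M → Win d M → Win d (Ys ++ map (rename ι) L)
win-elim zero = replace (elim-replacement (λ ()))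
win-elim (suc d) = replace (elim-replacement (λ { refl → win-elim d }))

split⁻¹ : Split X Q R → Win d (X ∷ L) → Win d (Q ∷ R ∷ L)
split⁻¹ {Q = Q} {R} {d} {L} s w =
  subst (Win d) (map-rename-id (Q ∷ R ∷ L)) (win-elim d (e-split s) hd w)

new⁻¹ : Win d (new P ∷ L) → Win d (P ∷ map wk L)
new⁻¹ {d = d} {P = P} {L = L} w =
  subst (λ N → Win d (N ∷ map wk L)) (rename-id (λ _ → refl) P)
    (win-elim d (e-new id (λ _ → refl)) hd w)

unwk : Win d (map wk L) → Win d L
unwk {d = d} {L = L} w = subst (Win d)
  (trans (map-rename-∘ (sub0-wk (fr 0)) L) (map-rename-id L)) (win-rename (sub0N (fr 0)) w)

-- An inert term can be split all the way down to `nil`: its sums have inert sides.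
drop-inert : (P : Proc false n) → Inert P → Win d (P ∷ L) → Win d L
drop-inert {d = d} {L} nil i w = subst (Win d) (map-rename-id L) (win-elim d e-nil hd w)
drop-inert (inp _ _) i w = ⊥-elim (i tt)
drop-inert (out _ _ _) i w = ⊥-elim (i tt)
drop-inert (tau _) i w = ⊥-elim (i tt)
drop-inert (P ⊕ Q) i w = drop-inert Q (i ∘ inj₂)
  (drop-inert P (i ∘ inj₁) (split⁻¹ (s-sum (inj₁ (i ∘ inj₁))) w))
drop-inert (P ∥ Q) i w = drop-inert Q (i ∘ inj₂) (drop-inert P (i ∘ inj₁) (split⁻¹ s-par w))
drop-inert (new P) i w = unwk (drop-inert P i (new⁻¹ w))
drop-inert (bang _) i w = ⊥-elim (i tt)
drop-inert ok i w = ⊥-elim (i tt)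

-- Win d is invariant under ≡ₛ: induction on d, then on the derivation of ≡ₛ.

infix 4 _⊑⟨_⟩_
_⊑⟨_⟩_ : Proc false n → ℕ → Proc false n → Set
P ⊑⟨ d ⟩ Q = ∀ {L} → Win d (P ∷ L) → Win d (Q ∷ L)

-- Renamings are built in because opening a restriction elsewhere weakens the thread, and `c-new`
-- goes under a binder.
Stable⊑ : ℕ → Proc false n → Proc false n → Set
Stable⊑ {n = n} d P Q = ∀ {j} (ρ : Nm n → Nm j) → rename ρ P ⊑⟨ d ⟩ rename ρ Q

module _ (d : ℕ)
  (below : ∀ {e} → d ≡ suc e → ∀ {n} {P Q : Proc false n} → P ≡ₛ Q → P ⊑⟨ e ⟩ Q) where

  ≈-continues : d ≡ suc e → π ≈ π' → Continues e π π'
  ≈-continues q (≈-tau E) = k-tau (below q E)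
  ≈-continues q (≈-inp E) = k-inp (λ y → below q (rename-≡ₛ E (sub0N y)))
  ≈-continues q (≈-out E) = k-out (below q E)

  -- The original pair X₀, Y₀ is kept together with its renamings, so that the answer to a split,
  -- given for all renamings, survives weakening. Replication has its own case because its unfolding
  -- contains it again.
  data Swap {n j : ℕ} (ι : Nm n → Nm j) : Proc false n → List (Proc false j) → Set where
    swap-thread : ∀ {n₀} {X₀ Y₀ : Proc false n₀} {X Y}
      (θ : Nm n₀ → Nm n) (θ' : Nm n₀ → Nm j) → (∀ x → ι (θ x) ≡ θ' x) →
      X ≡ rename θ X₀ → Y ≡ rename θ' Y₀ → X₀ ≡ₛ Y₀ → (∀ {P} → ¬ X ≡ new P) →
      (∀ {k} (ρ : Nm n₀ → Nm k) {Q R L} → Split (rename ρ X₀) Q R →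
        Win d (Q ∷ R ∷ L) → Win d (rename ρ Y₀ ∷ L)) →
      Swap ι X (Y ∷ [])
    swap-bang : ∀ {n₀} {X₀ Y₀ : Proc false n₀} {X Y}
      (θ : Nm n₀ → Nm n) (θ' : Nm n₀ → Nm j) → (∀ x → ι (θ x) ≡ θ' x) →
      X ≡ rename θ X₀ → Y ≡ rename θ' Y₀ → X₀ ≡ₛ Y₀ → Stable⊑ d X₀ Y₀ →
      Swap ι (bang X) (bang Y ∷ [])

  wk-not-new : (X : Proc false n) → (∀ {P} → ¬ X ≡ new P) → ∀ {P} → ¬ wk X ≡ new P
  wk-not-new (new P) h _ = h refl

  swap-wk : Swap ι X Ys → Swap (ext ι) (wk X) (map wk Ys)
  swap-wk {ι = ι} (swap-thread {X₀ = X₀} {Y₀} {X} θ θ' h refl refl E nn f) =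
    swap-thread (wkN ∘ θ) (wkN ∘ θ') (λ x → trans (ext-wkN ι (θ x)) (cong wkN (h x)))
      (rename-∘ (λ _ → refl) X₀) (rename-∘ (λ _ → refl) Y₀) E (wk-not-new X nn) f
  swap-wk {ι = ι} (swap-bang {X₀ = X₀} {Y₀} θ θ' h refl refl E f) =
    swap-bang (wkN ∘ θ) (wkN ∘ θ') (λ x → trans (ext-wkN ι (θ x)) (cong wkN (h x)))
      (rename-∘ (λ _ → refl) X₀) (rename-∘ (λ _ → refl) Y₀) E f

  swap-≡ₛ : Swap ι X Ys → ∃[ Y ] (rename ι X ≡ₛ Y × Ys ≡ Y ∷ [])
  swap-≡ₛ (swap-thread {X₀ = X₀} {Y₀} θ θ' h refl refl E _ _) =
    _ , subst (_≡ₛ rename θ' Y₀) (sym (rename-∘ h X₀)) (rename-≡ₛ E θ') , refl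
  swap-≡ₛ (swap-bang {X₀ = X₀} {Y₀} θ θ' h refl refl E _) =
    _ , c-bang (subst (_≡ₛ rename θ' Y₀) (sym (rename-∘ h X₀)) (rename-≡ₛ E θ')) , refl

  swap-ok : Swap ι X Ys → Unguarded✓ X → ∃[ Y ] ∃[ K ] (Pick Y K Ys × Unguarded✓ Y)
  swap-ok {ι = ι} {X = X} r u with swap-≡ₛ r
  ... | _ , E , refl = _ , _ , hd ,
    Equivalence.to (Ok-≡ₛ E) (Equivalence.from (Ok-rename ι X) u)

  swap-↘ : d ≡ suc e → Swap ι X Ys → X ↘ π →
    ∃[ Y ] ∃[ K ] ∃[ π' ] (Pick Y K Ys × Y ↘ π' × Continues e (renameP ι π) π')
  swap-↘ {ι = ι} q r o with swap-≡ₛ r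
  ... | _ , E , refl with proj₁ (⊑ₒ-≡ₛ E) (↘-rename ι o)
  ...   | _ , o' , c = _ , _ , _ , hd , o' , ≈-continues q c

  swap-below : d ≡ suc e → Swap ι X Ys → Pick X L M → Win e M → Win e (Ys ++ map (rename ι) L)
  swap-below {ι = ι} q r p w with swap-≡ₛ r
  ... | _ , E , refl = below q E (win-rename ι (win-⊑ w (pick-⊑ p)))

  swap-split : Swap ι X Ys → Split X Q R → Win d (Q ∷ R ∷ L) →
    (∀ {X' Ys' K} → Swap ι X' Ys' → Pick X' K (Q ∷ R ∷ L) → Win d (Ys' ++ map (rename ι) K)) →
    Win d (Ys ++ map (rename ι) L)
  swap-split {ι = ι} (swap-thread {Y₀ = Y₀} θ θ' h refl refl E _ f) s w _ =
    subst (λ N → Win d (N ∷ _)) (rename-∘ h Y₀) (win-rename ι (f θ s w))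
  swap-split {ι = ι} r@(swap-bang {X₀ = X₀} θ θ' h refl refl E f) s-bang w rec =
    -- The induction hypothesis `rec` replaces the replication that remains after unfolding; `f`
    -- then replaces the unfolded copy.
    w-split hd s-bang
      (f θ' (subst (λ N → Win d (N ∷ _)) (rename-∘ h X₀) (win-⊑ (rec r (tl hd)) ⊑-swap)))

  swap-new : Swap ι (new P) Ys → Win d (P ∷ map wk L) → Win d (Ys ++ map (rename ι) L)
  swap-new (swap-thread _ _ _ _ _ _ nn _) _ = ⊥-elim (nn refl)

  win-swap : Swap ι X Ys → Win d (X ∷ L) → Win d (Ys ++ map (rename ι) L)
  win-swap r = replace (record
    { Rep = Swap ; rep-wk = swap-wk ; rep-ok = swap-ok ; rep-split = swap-split
    ; rep-new = swap-new ; rep-↘ = swap-↘ ; rep-below = swap-below }) r hd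

  -- Reduces a law to the question of how to answer a split of its left side: offers and unguarded ✓
  -- are already invariant, and restrictions are excluded.
  thread : {X Y : Proc false n} → X ≡ₛ Y → (∀ {j} (ρ : Nm n → Nm j) {P} → ¬ rename ρ X ≡ new P) →
    (∀ {k} (ρ : Nm n → Nm k) {Q R L} → Split (rename ρ X) Q R →
        Win d (Q ∷ R ∷ L) → Win d (rename ρ Y ∷ L)) → Stable⊑ d X Y
  thread E nn f ρ {L} w = subst (λ N → Win d (_ ∷ N)) (map-rename-id L)
    (win-swap (swap-thread ρ ρ (λ _ → refl) refl refl E (nn ρ) f) w)

  bang-cong : P ≡ₛ Q → Stable⊑ d P Q → Stable⊑ d (bang P) (bang Q)
  bang-cong E f ρ {L} w = subst (λ N → Win d (_ ∷ N)) (map-rename-id L)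
    (win-swap (swap-bang ρ ρ (λ _ → refl) refl refl E f) w)

  sumˡ-cong : P ≡ₛ P' → Stable⊑ d P P' → Stable⊑ d (P ⊕ Q) (P' ⊕ Q)
  sumˡ-cong E f = thread (c-sumˡ E) (λ _ ())
    (λ { ρ (s-sum i) w → w-split hd (s-sum (Sum.map₁ (inert-≡ₛ (rename-≡ₛ E ρ)) i)) (f ρ w) })

  sumʳ-cong : Q ≡ₛ Q' → Stable⊑ d Q Q' → Stable⊑ d (P ⊕ Q) (P ⊕ Q')
  sumʳ-cong E f = thread (c-sumʳ E) (λ _ ())
    (λ { ρ (s-sum i) w → w-split hd (s-sum (Sum.map₂ (inert-≡ₛ (rename-≡ₛ E ρ)) i))
           (win-⊑ (f ρ (win-⊑ w ⊑-swap)) ⊑-swap) })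

  sum-comm⊑ : Stable⊑ d (P ⊕ Q) (Q ⊕ P)
  sum-comm⊑ = thread sum-comm (λ _ ())
    (λ { ρ (s-sum i) w → w-split hd (s-sum (Sum.swap i)) (win-⊑ w ⊑-swap) })

  padʳ : (R : Proc false n) → Inert R → Stable⊑ d Q (Q ⊕ R)
  padʳ R i ρ w = w-split hd (s-sum (inj₂ (inert-rename ρ {R} i))) (win-⊑ w (hd ∷ ⊑-skip ⊑-refl))

  padˡ : (R : Proc false n) → Inert R → Stable⊑ d Q (R ⊕ Q)
  padˡ R i ρ w = w-split hd (s-sum (inj₁ (inert-rename ρ {R} i))) (win-⊑ w (⊑-skip ⊑-refl))

  ≡-padʳ : (R : Proc false n) → Inert R → Q ≡ₛ Q ⊕ R
  ≡-padʳ R i = trans≡ (sym≡ sum-unit) (c-sumʳ (sym≡ (inert-≡nil R i)))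

  unpad : Stable⊑ d P Q → P ⊑⟨ d ⟩ Q
  unpad {P = P} {Q} f {L} w = subst (λ N → Win d (N ∷ L)) (rename-id (λ _ → refl) Q)
    (f id (subst (λ N → Win d (N ∷ L)) (sym (rename-id (λ _ → refl) P)) w))

  sum-assocʳ : Stable⊑ d ((P ⊕ Q) ⊕ R) (P ⊕ (Q ⊕ R))
  sum-assocʳ = thread sum-assoc (λ _ ()) (λ _ → split)
    where
    split : {P Q R A B : Proc false l} {L : List (Proc false l)} → Split ((P ⊕ Q) ⊕ R) A B →
      Win d (A ∷ B ∷ L) → Win d (P ⊕ (Q ⊕ R) ∷ L)
    split (s-sum (inj₁ i)) w =
      w-split hd (s-sum (inj₁ (i ∘ inj₁)))
        (w-split (tl hd) (s-sum (inj₁ (i ∘ inj₂)))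
          (win-⊑ (split⁻¹ (s-sum (inj₁ (i ∘ inj₁))) w) (tl (tl hd) ∷ ⊑-refl)))
    -- P ⊕ Q may still be a genuine choice, so it is not split: the inert R is dropped and
    -- reinserted next to Q.
    split {R = R} (s-sum (inj₂ i)) w =
      unpad (sumʳ-cong (≡-padʳ R i) (padʳ R i)) (drop-inert R i (win-⊑ w ⊑-swap))

  sum-assocˡ : Stable⊑ d (P ⊕ (Q ⊕ R)) ((P ⊕ Q) ⊕ R)
  sum-assocˡ = thread (sym≡ sum-assoc) (λ _ ()) (λ _ → split)
    where
    split : {P Q R A B : Proc false l} {L : List (Proc false l)} → Split (P ⊕ (Q ⊕ R)) A B →
      Win d (A ∷ B ∷ L) → Win d ((P ⊕ Q) ⊕ R ∷ L)
    split {P = P} (s-sum (inj₁ i)) w =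
      unpad (sumˡ-cong (trans≡ (≡-padʳ P i) sum-comm) (padˡ P i)) (drop-inert P i w)
    split (s-sum (inj₂ i)) w =
      w-split hd (s-sum (inj₂ (i ∘ inj₂)))
        (w-split hd (s-sum (inj₂ (i ∘ inj₁)))
          (win-⊑ (split⁻¹ (s-sum (inj₁ (i ∘ inj₁))) (win-⊑ w ⊑-swap))
            (tl hd ∷ (tl hd ∷ ⊑-refl))))

  new-swap⊑ : (P : Proc false (suc (suc n))) → new (new P) ⊑⟨ d ⟩ new (new (rename swapN P))
  new-swap⊑ P {L} w = w-new hd (w-new hd
    (subst (λ N → Win d (rename swapN P ∷ N))
      (trans (cong (map (rename swapN)) (map-rename-∘ (λ _ → refl) L))
        (trans (map-rename-∘ (swap-wkwk) L) (sym (map-rename-∘ (λ _ → refl) L))))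
      (win-rename swapN (new⁻¹ (new⁻¹ w)))))

  new-par→ : (P : Proc false n) (Q : Proc false (suc n)) → new (wk P ∥ Q) ⊑⟨ d ⟩ P ∥ new Q
  new-par→ P Q w = w-split hd s-par
    (w-new (tl hd) (win-⊑ (split⁻¹ s-par (new⁻¹ w)) ⊑-swap))

  new-par← : (P : Proc false n) (Q : Proc false (suc n)) → P ∥ new Q ⊑⟨ d ⟩ new (wk P ∥ Q)
  new-par← P Q w = w-new hd (w-split hd s-par
    (win-⊑ (new⁻¹ (win-⊑ (split⁻¹ s-par w) ⊑-swap)) ⊑-swap))

  -- The laws of parallel composition and restriction follow from invertibility. Prefix congruences
  -- and most sum laws need `thread`, because those terms can act without being split.
  stable-≡ₛ : {P Q : Proc false n} → P ≡ₛ Q → Stable⊑ d P Q × Stable⊑ d Q P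
  stable-≡ₛ refl≡ = (λ ρ → id) , (λ ρ → id)
  stable-≡ₛ (sym≡ E) = proj₂ (stable-≡ₛ E) , proj₁ (stable-≡ₛ E)
  stable-≡ₛ (trans≡ E F) =
    (λ ρ w → proj₁ (stable-≡ₛ F) ρ (proj₁ (stable-≡ₛ E) ρ w)) ,
    (λ ρ w → proj₂ (stable-≡ₛ E) ρ (proj₂ (stable-≡ₛ F) ρ w))
  stable-≡ₛ (c-inp E) = thread (c-inp E) (λ _ ()) (λ _ ()) , thread (c-inp (sym≡ E)) (λ _ ()) (λ _ ())
  stable-≡ₛ (c-out E) = thread (c-out E) (λ _ ()) (λ _ ()) , thread (c-out (sym≡ E)) (λ _ ()) (λ _ ())
  stable-≡ₛ (c-tau E) = thread (c-tau E) (λ _ ()) (λ _ ()) , thread (c-tau (sym≡ E)) (λ _ ()) (λ _ ())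
  stable-≡ₛ (c-mat {t = ()} E)
  stable-≡ₛ (c-sumˡ E) =
    sumˡ-cong E (proj₁ (stable-≡ₛ E)) , sumˡ-cong (sym≡ E) (proj₂ (stable-≡ₛ E))
  stable-≡ₛ (c-sumʳ E) =
    sumʳ-cong E (proj₁ (stable-≡ₛ E)) , sumʳ-cong (sym≡ E) (proj₂ (stable-≡ₛ E))
  stable-≡ₛ (c-parˡ E) =
    (λ ρ w → w-split hd s-par (proj₁ (stable-≡ₛ E) ρ (split⁻¹ s-par w))) ,
    (λ ρ w → w-split hd s-par (proj₂ (stable-≡ₛ E) ρ (split⁻¹ s-par w)))
  stable-≡ₛ (c-parʳ E) =
    (λ ρ w → w-split hd s-par
      (win-⊑ (proj₁ (stable-≡ₛ E) ρ (win-⊑ (split⁻¹ s-par w) ⊑-swap)) ⊑-swap)) ,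
    (λ ρ w → w-split hd s-par
      (win-⊑ (proj₂ (stable-≡ₛ E) ρ (win-⊑ (split⁻¹ s-par w) ⊑-swap)) ⊑-swap))
  stable-≡ₛ (c-new E) =
    (λ ρ w → w-new hd (proj₁ (stable-≡ₛ E) (ext ρ) (new⁻¹ w))) ,
    (λ ρ w → w-new hd (proj₂ (stable-≡ₛ E) (ext ρ) (new⁻¹ w)))
  stable-≡ₛ (c-bang E) =
    bang-cong E (proj₁ (stable-≡ₛ E)) , bang-cong (sym≡ E) (proj₂ (stable-≡ₛ E))
  stable-≡ₛ par-unit =
    (λ ρ w → drop-inert nil id (win-⊑ (split⁻¹ s-par w) ⊑-swap)) ,
    (λ ρ w → w-split hd s-par (win-⊑ w (hd ∷ ⊑-skip ⊑-refl)))
  stable-≡ₛ par-comm =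
    (λ ρ w → w-split hd s-par (win-⊑ (split⁻¹ s-par w) ⊑-swap)) ,
    (λ ρ w → w-split hd s-par (win-⊑ (split⁻¹ s-par w) ⊑-swap))
  stable-≡ₛ par-assoc =
    (λ ρ w → w-split hd s-par (w-split (tl hd) s-par
      (win-⊑ (split⁻¹ s-par (split⁻¹ s-par w)) (tl (tl hd) ∷ ⊑-refl)))) ,
    (λ ρ w → w-split hd s-par (w-split hd s-par
      (win-⊑ (split⁻¹ s-par (win-⊑ (split⁻¹ s-par w) ⊑-swap)) (tl hd ∷ (tl hd ∷ ⊑-refl)))))
  stable-≡ₛ sum-unit =
    (λ ρ w → drop-inert nil id (win-⊑ (split⁻¹ (s-sum (inj₂ id)) w) ⊑-swap)) , padʳ nil id
  stable-≡ₛ sum-comm = sum-comm⊑ , sum-comm⊑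
  stable-≡ₛ sum-assoc = sum-assocʳ , sum-assocˡ
  stable-≡ₛ new-nil =
    (λ ρ w → win-⊑ (unwk (drop-inert nil id (new⁻¹ w))) (⊑-skip ⊑-refl)) ,
    (λ ρ w → win-⊑ (drop-inert nil id w) (⊑-skip ⊑-refl))
  stable-≡ₛ (new-swap {P = P}) =
    (λ ρ w → subst (λ N → Win d (new (new N) ∷ _)) (sym (rename-square (swap-ext ρ) P))
      (new-swap⊑ _ w)) ,
    (λ ρ w → subst (λ N → Win d (new (new N) ∷ _)) (unswap ρ) (new-swap⊑ _ w))
    where
    unswap : (ρ : Nm _ → Nm j) →
      rename swapN (rename (ext (ext ρ)) (rename swapN P)) ≡ rename (ext (ext ρ)) P
    unswap ρ = trans (cong (rename swapN) (rename-square (swap-ext ρ) P))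
      (trans (rename-∘ swap-swap (rename (ext (ext ρ)) P)) (rename-id (λ _ → refl) _))
  stable-≡ₛ (new-par {P = P} {Q}) =
    (λ ρ w → new-par→ (rename ρ P) (rename (ext ρ) Q)
      (subst (λ N → Win d (new (N ∥ rename (ext ρ) Q) ∷ _)) (rename-wk ρ P) w)) ,
    (λ ρ w → subst (λ N → Win d (new (N ∥ rename (ext ρ) Q) ∷ _)) (sym (rename-wk ρ P))
      (new-par← (rename ρ P) (rename (ext ρ) Q) w))
  stable-≡ₛ bang-unf =
    (λ ρ w → w-split hd s-par (split⁻¹ s-bang w)) ,
    (λ ρ w → w-split hd s-bang (split⁻¹ s-par w))
  stable-≡ₛ (mat-refl {t = ()})

  ⊑-≡ₛ : P ≡ₛ Q → P ⊑⟨ d ⟩ Q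
  ⊑-≡ₛ E = unpad (proj₁ (stable-≡ₛ E))

win-≡ₛ : ∀ d → P ≡ₛ Q → P ⊑⟨ d ⟩ Q
win-≡ₛ zero = ⊑-≡ₛ zero (λ ())
win-≡ₛ (suc d) = ⊑-≡ₛ (suc d) (λ { refl → win-≡ₛ d })

-- `Win` characterises reaching success

Reach : Proc m n → Set
Reach P = ∃[ P' ] (P ⟶* P' × Unguarded✓ P')

reach-step : {P Q : Proc m n} → P ⟶ Q → Reach Q → Reach P
reach-step s (_ , ss , u) = _ , s ◅ ss , u

Wins : List (Proc false n) → Set
Wins M = ∃[ d ] Win d M

-- Each reduction rule is read backwards; `r-struc` adds nothing to the bound because `win-≡ₛ`
-- preserves it.
win-step : {P P' : Proc false n} → P ⟶ P' → Win d (P' ∷ L) → Win (suc d) (P ∷ L)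
win-step r-com w = w-split hd s-par
  (w-com hd hd (o-sumˡ o-inp) (o-sumˡ o-out) (split⁻¹ s-par w))
win-step r-tau w = w-tau hd (o-sumˡ o-tau) w
win-step (r-par s) w = w-split hd s-par (win-step s (split⁻¹ s-par w))
win-step (r-new s) w = w-new hd (win-step s (new⁻¹ w))
win-step {d = d} (r-struc E s F) w =
  win-≡ₛ (suc d) (sym≡ E) (win-step s (win-≡ₛ d (sym≡ F) w))

reach⇒wins : {P : Proc false n} → Reach P → Wins (P ∷ [])
reach⇒wins (_ , ε , u) = 0 , w-ok hd u
reach⇒wins (_ , s ◅ ss , u) = _ , win-step s (proj₂ (reach⇒wins (_ , ss , u)))

compose : List (Proc false n) → Proc false n
compose [] = nil
compose (P ∷ L) = P ∥ compose L

par-pick : Pick X L M → compose M ≡ₛ X ∥ compose L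
par-pick hd = refl≡
par-pick (tl p) = trans≡ (c-parʳ (par-pick p))
  (trans≡ (sym≡ par-assoc) (trans≡ (c-parˡ par-comm) par-assoc))

par-wk : (L : List (Proc false n)) → compose (map wk L) ≡ wk (compose L)
par-wk [] = refl
par-wk (P ∷ L) = cong (wk P ∥_) (par-wk L)

ok-pick : Pick X L M → Unguarded✓ X → Unguarded✓ (compose M)
ok-pick hd u = inj₁ u
ok-pick (tl p) u = inj₂ (ok-pick p u)

reach-≡ₛ : {P Q : Proc false n} → P ≡ₛ Q → Reach Q → Reach P
reach-≡ₛ E (_ , ε , u) = _ , ε , Equivalence.from (Ok-≡ₛ E) u
reach-≡ₛ E (_ , s ◅ ss , u) = _ , r-struc E s refl≡ ◅ ss , u

reach-new : {P : Proc false (suc n)} → Reach P → Reach (new P)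
reach-new (_ , ε , u) = _ , ε , u
reach-new (_ , s ◅ ss , u) = reach-step (r-new s) (reach-new (_ , ss , u))

-- For a sum, the inert side is erased by the unit law of ⊕ and put back by that of ∥.
split-∥ : Split P Q R → P ≡ₛ Q ∥ R
split-∥ s-par = refl≡
split-∥ (s-sum {P = P} {Q} (inj₁ i)) = trans≡ (c-sumˡ (inert-≡nil P i))
  (trans≡ sum-comm (trans≡ sum-unit (trans≡ (sym≡ par-unit)
    (trans≡ par-comm (c-parˡ (sym≡ (inert-≡nil P i)))))))
split-∥ (s-sum {P = P} {Q} (inj₂ i)) = trans≡ (c-sumʳ (inert-≡nil Q i))
  (trans≡ sum-unit (trans≡ (sym≡ par-unit) (c-parʳ (sym≡ (inert-≡nil Q i)))))
split-∥ s-bang = bang-unf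

wins⇒reach : Win d M → Reach (compose M)
wins⇒reach (w-ok p u) = _ , ε , ok-pick p u
wins⇒reach (w-split p s w) = reach-≡ₛ
  (trans≡ (par-pick p) (trans≡ (c-parˡ (split-∥ s)) par-assoc)) (wins⇒reach w)
wins⇒reach (w-new {P = P} {L = L} p w) = reach-≡ₛ
  (trans≡ (par-pick p) (trans≡ par-comm (trans≡ (sym≡ new-par) (c-new par-comm))))
  (reach-new (subst (λ N → Reach (P ∥ N)) (par-wk L) (wins⇒reach w)))
wins⇒reach (w-tau p o w) = reach-step
  (r-struc (trans≡ (par-pick p) (c-parˡ (proj₂ (↘-sound o)))) (r-par r-tau) refl≡)
  (wins⇒reach w)
wins⇒reach (w-com p q o o' w) = reach-step
  (r-struc
    (trans≡ (par-pick p) (trans≡ (c-parˡ (proj₂ (↘-sound o)))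
      (trans≡ (c-parʳ (trans≡ (par-pick q) (c-parˡ (proj₂ (↘-sound o'))))) (sym≡ par-assoc))))
    (r-par r-com) par-assoc)
  (wins⇒reach w)

-- Agreement of renamings in terms of free atoms

name-agree : (ρ θ : Nm n → Nm j) (x : Nm n) → (∀ i → ρ (bd i) ≡ θ (bd i)) →
  (∀ a → FreeInN a x → ρ (fr a) ≡ θ (fr a)) → ρ x ≡ θ x
name-agree ρ θ (fr a) b f = f a refl
name-agree ρ θ (bd i) b f = b i

ext-bound : {ρ θ : Nm n → Nm j} → (∀ i → ρ (bd i) ≡ θ (bd i)) →
  ∀ i → ext ρ (bd i) ≡ ext θ (bd i)
ext-bound b zero = refl
ext-bound b (suc i) = cong wkN (b i)

free⇒agree : {ρ θ : Nm n → Nm j} (P : Proc false n) → (∀ i → ρ (bd i) ≡ θ (bd i)) →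
  (∀ a → FreeIn a P → ρ (fr a) ≡ θ (fr a)) → Agree ρ θ P
free⇒agree nil b f = refl
free⇒agree {ρ = ρ} {θ} (inp x P) b f = cong₂ inp (name-agree ρ θ x b (λ a → f a ∘ inj₁))
  (free⇒agree P (ext-bound b) (λ a → cong wkN ∘ f a ∘ inj₂))
free⇒agree {ρ = ρ} {θ} (out x y P) b f = cong₃ out (name-agree ρ θ x b (λ a → f a ∘ inj₁))
  (name-agree ρ θ y b (λ a → f a ∘ inj₂ ∘ inj₁)) (free⇒agree P b (λ a → f a ∘ inj₂ ∘ inj₂))
free⇒agree (tau P) b f = cong tau (free⇒agree P b f)
free⇒agree (P ⊕ Q) b f =
  cong₂ _⊕_ (free⇒agree P b (λ a → f a ∘ inj₁)) (free⇒agree Q b (λ a → f a ∘ inj₂))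
free⇒agree (P ∥ Q) b f =
  cong₂ _∥_ (free⇒agree P b (λ a → f a ∘ inj₁)) (free⇒agree Q b (λ a → f a ∘ inj₂))
free⇒agree (new P) b f = cong new (free⇒agree P (ext-bound b) (λ a → cong wkN ∘ f a))
free⇒agree (bang P) b f = cong bang (free⇒agree P b f)
free⇒agree ok b f = refl

name-free : (ρ θ : Nm n → Nm j) {a : ℕ} (x : Nm n) → ρ x ≡ θ x → FreeInN a x → ρ (fr a) ≡ θ (fr a)
name-free ρ θ (fr _) e refl = e

agree⇒free : {ρ θ : Nm n → Nm j} {a : ℕ} (P : Proc false n) → Agree ρ θ P →
  FreeIn a P → ρ (fr a) ≡ θ (fr a)
agree⇒free {ρ = ρ} {θ} (inp x P) e (inj₁ q) = name-free ρ θ x (proj₁ (inp-inj e)) q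
agree⇒free {ρ = ρ} {θ} (inp x P) e (inj₂ q) = wkN-inj (agree⇒free P (proj₂ (inp-inj e)) q)
agree⇒free {ρ = ρ} {θ} (out x y P) e (inj₁ q) = name-free ρ θ x (proj₁ (out-inj e)) q
agree⇒free {ρ = ρ} {θ} (out x y P) e (inj₂ (inj₁ q)) = name-free ρ θ y (proj₁ (proj₂ (out-inj e))) q
agree⇒free {ρ = ρ} {θ} (out x y P) e (inj₂ (inj₂ q)) = agree⇒free P (proj₂ (proj₂ (out-inj e))) q
agree⇒free (tau P) e q = agree⇒free P (tau-inj e) q
agree⇒free (P ⊕ Q) e (inj₁ q) = agree⇒free P (proj₁ (⊕-inj e)) q
agree⇒free (P ⊕ Q) e (inj₂ q) = agree⇒free Q (proj₂ (⊕-inj e)) q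
agree⇒free (P ∥ Q) e (inj₁ q) = agree⇒free P (proj₁ (∥-inj e)) q
agree⇒free (P ∥ Q) e (inj₂ q) = agree⇒free Q (proj₂ (∥-inj e)) q
agree⇒free (new P) e q = wkN-inj (agree⇒free P (new-inj e) q)
agree⇒free (bang P) e q = agree⇒free P (bang-inj e) q

-- A form of success that remains available when the term becomes one side of a sum.
Eager : Proc false n → Set
Eager P = Unguarded✓ P ⊎ (∃[ R ] (P ↘ tauP R × Wins (R ∷ [])))

eager⇒wins : Eager P → Wins (P ∷ [])
eager⇒wins (inj₁ u) = 0 , w-ok hd u
eager⇒wins (inj₂ (_ , o , _ , w)) = _ , w-tau hd o w

-- A thread that offers some prefix is a sum, so if it succeeds on its own
-- it starts with one of its own τ-summands.
offers⇒eager : {P : Proc false n} → P ↘ π → Wins (P ∷ []) → Eager P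
offers⇒eager {n} {π} {P} o (d , w) with ↘-sound o
... | M , E = start (win-≡ₛ d E w)
  where
  fire : ∀ {R} → prefix π ⊕ M ↘ tauP R → Win e (R ∷ []) → Eager P
  fire {e} o' w' with proj₂ (⊑ₒ-≡ₛ E) o'
  ... | _ , o'' , ≈-tau F = inj₂ (_ , o'' , _ , win-≡ₛ e F w')

  single : ∀ π → (∀ {e R} → prefix π ↘ tauP R → Win e (R ∷ []) → Eager P) →
    Win e (prefix π ∷ []) → Eager P
  single (tauP _) f (w-tau hd o' w') = f o' w'
  single (tauP _) f (w-com hd () _ _ _)
  single (inpP _ _) f (w-tau hd () _)
  single (inpP _ _) f (w-com hd () _ _ _)
  single (outP _ _ _) f (w-tau hd () _)
  single (outP _ _ _) f (w-com hd () _ _ _)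
  single (tauP _) f (w-ok hd ())
  single (inpP _ _) f (w-ok hd ())
  single (outP _ _ _) f (w-ok hd ())
  single (tauP _) f (w-split hd () _)
  single (inpP _ _) f (w-split hd () _)
  single (outP _ _ _) f (w-split hd () _)
  single (tauP _) f (w-new (tl ()) _)
  single (inpP _ _) f (w-new (tl ()) _)
  single (outP _ _ _) f (w-new (tl ()) _)

  active : ∀ π → Act (prefix {n} π)
  active (tauP _) = tt
  active (inpP _ _) = tt
  active (outP _ _ _) = tt

  -- A lone sum has no partner to communicate with. It can be split only if M is inert, and then the
  -- prefix must act alone.
  start : Win e (prefix π ⊕ M ∷ []) → Eager P
  start (w-ok hd u) = inj₁ (Equivalence.from (Ok-≡ₛ E) u)
  start (w-split hd (s-sum (inj₁ i)) _) = ⊥-elim (i (active π))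
  start (w-split hd (s-sum (inj₂ i)) w') =
    single π (λ o' → fire (o-sumˡ o')) (drop-inert M i (win-⊑ w' ⊑-swap))
  start (w-new (tl ()) _)
  start (w-tau hd o' w') = fire o' w'
  start (w-com hd () _ _ _)

-- Replacement of T₁ by T₂ inside arbitrary contexts.  Wherever T₁ is exposed
-- as a thread, T₂ succeeds by itself; the remaining conditions cover T₁
-- exposed inside a sum, where it can only block, count as success, offer a
-- summand, or prevent a restriction from being vacuous.
record _≼_ (T₁ T₂ : Target) : Set where
  field
    active : ¬ Inert T₁
    names  : ∀ a → FreeIn a T₂ → FreeIn a T₁
    oks    : Unguarded✓ T₁ → Unguarded✓ T₂
    wins   : Wins (T₂ ∷ [])
    offers : (∀ {π} → ¬ T₁ ↘ π) ⊎ Eager T₂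

module _ {T₁ T₂ : Target} (T₁≼T₂ : T₁ ≼ T₂) where
  open _≼_ T₁≼T₂

  infix 4 _▷_ _▷ₚ_
  -- Each copy of T₁ carries its own renaming, since the context may duplicate it, bind its names
  -- and receive values for them.
  data _▷_ : ∀ {n} → Proc false n → Proc false n → Set where
    ▷-here : {P Q : Proc false n} (ρ : Nm 0 → Nm n) → P ≡ rename ρ T₁ → Q ≡ rename ρ T₂ → P ▷ Q
    ▷-nil  : nil {n = n} ▷ nil
    ▷-inp  : {x : Nm n} {P Q : Proc false (suc n)} → P ▷ Q → inp x P ▷ inp x Q
    ▷-out  : {x y : Nm n} {P Q : Proc false n} → P ▷ Q → out x y P ▷ out x y Q
    ▷-tau  : {P Q : Proc false n} → P ▷ Q → tau P ▷ tau Q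
    ▷-sum  : {P P' Q Q' : Proc false n} → P ▷ Q → P' ▷ Q' → P ⊕ P' ▷ Q ⊕ Q'
    ▷-par  : {P P' Q Q' : Proc false n} → P ▷ Q → P' ▷ Q' → P ∥ P' ▷ Q ∥ Q'
    ▷-new  : {P Q : Proc false (suc n)} → P ▷ Q → new P ▷ new Q
    ▷-bang : {P Q : Proc false n} → P ▷ Q → bang P ▷ bang Q
    ▷-ok   : ok {n = n} ▷ ok

  data _▷ₚ_ {n : ℕ} : Pre n → Pre n → Set where
    ▷-tauP : {P Q : Proc false n} → P ▷ Q → tauP P ▷ₚ tauP Q
    ▷-inpP : {x : Nm n} {P Q : Proc false (suc n)} → P ▷ Q → inpP x P ▷ₚ inpP x Q
    ▷-outP : {x y : Nm n} {P Q : Proc false n} → P ▷ Q → outP x y P ▷ₚ outP x y Q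

  ▷-rename : (ρ : Nm n → Nm j) {P Q : Proc false n} → P ▷ Q → rename ρ P ▷ rename ρ Q
  ▷-rename ρ (▷-here θ refl refl) =
    ▷-here (ρ ∘ θ) (rename-∘ (λ _ → refl) T₁) (rename-∘ (λ _ → refl) T₂)
  ▷-rename ρ ▷-nil = ▷-nil
  ▷-rename ρ (▷-inp r) = ▷-inp (▷-rename (ext ρ) r)
  ▷-rename ρ (▷-out r) = ▷-out (▷-rename ρ r)
  ▷-rename ρ (▷-tau r) = ▷-tau (▷-rename ρ r)
  ▷-rename ρ (▷-sum r s) = ▷-sum (▷-rename ρ r) (▷-rename ρ s)
  ▷-rename ρ (▷-par r s) = ▷-par (▷-rename ρ r) (▷-rename ρ s)
  ▷-rename ρ (▷-new r) = ▷-new (▷-rename (ext ρ) r)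
  ▷-rename ρ (▷-bang r) = ▷-bang (▷-rename ρ r)
  ▷-rename ρ ▷-ok = ▷-ok

  ▷-agree : {ρ θ : Nm n → Nm j} {P Q : Proc false n} → P ▷ Q → Agree ρ θ P → Agree ρ θ Q
  ▷-agree {ρ = ρ} {θ} (▷-here ζ refl refl) e =
    trans (rename-∘ (λ _ → refl) T₂)
      (trans (free⇒agree T₂ (λ ()) (λ a q → agree⇒free T₁ e' (names a q)))
        (sym (rename-∘ (λ _ → refl) T₂)))
    where
    e' : Agree (ρ ∘ ζ) (θ ∘ ζ) T₁
    e' = trans (sym (rename-∘ (λ _ → refl) T₁)) (trans e (rename-∘ (λ _ → refl) T₁))
  ▷-agree ▷-nil e = refl
  ▷-agree (▷-inp r) e = let (a , b) = inp-inj e in cong₂ inp a (▷-agree r b)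
  ▷-agree (▷-out r) e = let (a , b , c) = out-inj e in cong₃ out a b (▷-agree r c)
  ▷-agree (▷-tau r) e = cong tau (▷-agree r (tau-inj e))
  ▷-agree (▷-sum r s) e = let (a , b) = ⊕-inj e in cong₂ _⊕_ (▷-agree r a) (▷-agree s b)
  ▷-agree (▷-par r s) e = let (a , b) = ∥-inj e in cong₂ _∥_ (▷-agree r a) (▷-agree s b)
  ▷-agree (▷-new r) e = cong new (▷-agree r (new-inj e))
  ▷-agree (▷-bang r) e = cong bang (▷-agree r (bang-inj e))
  ▷-agree ▷-ok e = refl

  -- T₂ has no names beyond those of T₁, so a restriction that is vacuous on the left is vacuous on
  -- the right.
  ▷-wk : {P : Proc false n} {Q : Proc false (suc n)} → wk P ▷ Q →
    Q ≡ wk (Q [ fr 0 ]) × P ▷ (Q [ fr 0 ])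
  ▷-wk {P = P} {Q} r = unreset Q (▷-agree r (reset-wk P)) ,
    subst (_▷ (Q [ fr 0 ])) (wk-[] P (fr 0)) (▷-rename (sub0N (fr 0)) r)

  -- T₁ is active and so never exposed in an inert term. Hence a sum or parallel composition that
  -- opens up on the left also does so on the right.
  ▷-inert : {P Q : Proc false n} → P ▷ Q → Inert P → Inert Q
  ▷-inert (▷-here ρ refl refl) i _ = active (i ∘ Equivalence.from (Act-rename ρ T₁))
  ▷-inert ▷-nil i = i
  ▷-inert (▷-inp _) i = i
  ▷-inert (▷-out _) i = i
  ▷-inert (▷-tau _) i = i
  ▷-inert (▷-sum r s) i = [ ▷-inert r (i ∘ inj₁) , ▷-inert s (i ∘ inj₂) ]′
  ▷-inert (▷-par r s) i = [ ▷-inert r (i ∘ inj₁) , ▷-inert s (i ∘ inj₂) ]′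
  ▷-inert (▷-new r) i = ▷-inert r i
  ▷-inert (▷-bang _) i = i
  ▷-inert ▷-ok i = i

  ▷-ok✓ : {P Q : Proc false n} → P ▷ Q → Unguarded✓ P → Unguarded✓ Q
  ▷-ok✓ (▷-here ρ refl refl) u =
    Equivalence.from (Ok-rename ρ T₂) (oks (Equivalence.to (Ok-rename ρ T₁) u))
  ▷-ok✓ (▷-sum r s) = Sum.map (▷-ok✓ r) (▷-ok✓ s)
  ▷-ok✓ (▷-par r s) = Sum.map (▷-ok✓ r) (▷-ok✓ s)
  ▷-ok✓ (▷-new r) u = ▷-ok✓ r u
  ▷-ok✓ (▷-bang r) u = ▷-ok✓ r u
  ▷-ok✓ ▷-ok u = u

  eager-rename : (ρ : Nm n → Nm j) {P : Proc false n} → Eager P → Eager (rename ρ P)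
  eager-rename ρ {P} (inj₁ u) = inj₁ (Equivalence.from (Ok-rename ρ P) u)
  eager-rename ρ (inj₂ (_ , o , _ , w)) = inj₂ (_ , ↘-rename ρ o , _ , win-rename ρ w)

  eager-map : (Unguarded✓ P → Unguarded✓ Q) → (∀ {R} → P ↘ tauP R → Q ↘ tauP R) → Eager P → Eager Q
  eager-map f g = Sum.map f (λ (_ , o , w) → _ , g o , w)

  -- If the offer comes from T₁ itself, no matching summand is required: Q succeeds at once, in a
  -- form that survives the enclosing sums.
  Imitates : Proc false n → Pre n → Set
  Imitates Q π = (∃[ π' ] (Q ↘ π' × π ▷ₚ π')) ⊎ Eager Q

  imitates-map : (Unguarded✓ P → Unguarded✓ Q) → (∀ {π} → P ↘ π → Q ↘ π) →
    Imitates P π → Imitates Q π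
  imitates-map f g = Sum.map (λ (_ , o , r) → _ , g o , r) (eager-map f g)

  ▷-here-↘ : (ρ : Nm 0 → Nm n) {π : Pre n} → rename ρ T₁ ↘ π → Imitates (rename ρ T₂) π
  ▷-here-↘ ρ o with offers
  ... | inj₁ f = ⊥-elim (f (proj₂ (↘-unrename ρ T₁ o)))
  ... | inj₂ g = inj₂ (eager-rename ρ g)

  ▷-↘ : {P Q : Proc false n} {π : Pre n} → P ▷ Q → P ↘ π → Imitates Q π
  ▷-↘ (▷-here ρ refl refl) o = ▷-here-↘ ρ o
  ▷-↘ (▷-inp r) o-inp = inj₁ (_ , o-inp , ▷-inpP r)
  ▷-↘ (▷-out r) o-out = inj₁ (_ , o-out , ▷-outP r)
  ▷-↘ (▷-tau r) o-tau = inj₁ (_ , o-tau , ▷-tauP r)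
  ▷-↘ (▷-sum r s) (o-sumˡ o) = imitates-map inj₁ o-sumˡ (▷-↘ r o)
  ▷-↘ (▷-sum r s) (o-sumʳ o) = imitates-map inj₂ o-sumʳ (▷-↘ s o)
  ▷-↘ (▷-par r s) (o-parˡ o i) = imitates-map inj₁ (λ o' → o-parˡ o' (▷-inert s i)) (▷-↘ r o)
  ▷-↘ (▷-par r s) (o-parʳ o i) = imitates-map inj₂ (λ o' → o-parʳ o' (▷-inert r i)) (▷-↘ s o)
  ▷-↘ (▷-new {Q = Q} r) (o-new {P₀ = P₀} refl o) with ▷-wk r
  ... | q , r₀ = imitates-map
    (λ u → subst Unguarded✓ (sym q) (Equivalence.from (Ok-rename wkN (Q [ fr 0 ])) u))
    (o-new q) (▷-↘ r₀ o)

  ▷-split : {P Q A B : Proc false n} → P ▷ Q → Split P A B →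
    Wins (Q ∷ []) ⊎ (∃[ A' ] ∃[ B' ] (Split Q A' B' × A ▷ A' × B ▷ B'))
  ▷-split (▷-here ρ refl refl) _ = inj₁ (_ , win-rename ρ (proj₂ wins))
  ▷-split (▷-par r s) s-par = inj₂ (_ , _ , s-par , r , s)
  ▷-split (▷-sum r s) (s-sum i) =
    inj₂ (_ , _ , s-sum (Sum.map (▷-inert r) (▷-inert s) i) , r , s)
  ▷-split (▷-bang r) s-bang = inj₂ (_ , _ , s-bang , r , ▷-bang r)

  ▷-pick : {M M' : List (Proc false n)} → Pick X L M → Pointwise _▷_ M M' →
    ∃[ Y ] ∃[ L' ] (Pick Y L' M' × X ▷ Y × Pointwise _▷_ L L')
  ▷-pick hd (r ∷ rs) = _ , _ , hd , r , rs
  ▷-pick (tl p) (r ∷ rs) with ▷-pick p rs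
  ... | _ , _ , p' , r' , rs' = _ , _ , tl p' , r' , r ∷ rs'

  wins-pick : Pick X L M → Wins (X ∷ []) → Wins M
  wins-pick p (_ , w) = _ , win-⊑ w (p ∷ [])

  -- Follows the left derivation in lockstep until it uses T₁ itself by splitting, opening or firing
  -- it; from there T₂ wins alone, with a bound of its own.
  ▷-win : {M M' : List (Proc false n)} → Win d M → Pointwise _▷_ M M' → Wins M'
  ▷-win (w-ok p u) rs with ▷-pick p rs
  ... | _ , _ , p' , r , _ = 0 , w-ok p' (▷-ok✓ r u)
  ▷-win (w-split p s w) rs with ▷-pick p rs
  ... | _ , _ , p' , r , rs' with ▷-split r s
  ...   | inj₁ v = wins-pick p' v
  ...   | inj₂ (_ , _ , s' , rA , rB) = _ , w-split p' s' (proj₂ (▷-win w (rA ∷ rB ∷ rs')))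
  ▷-win (w-new p w) rs with ▷-pick p rs
  ... | _ , _ , p' , ▷-here ρ _ refl , _ = wins-pick p' (_ , win-rename ρ (proj₂ wins))
  ... | _ , _ , p' , ▷-new r , rs' =
    _ , w-new p' (proj₂ (▷-win w (r ∷ Pointwise.map⁺ wk wk (Pointwise.map (▷-rename wkN) rs'))))
  ▷-win (w-tau p o w) rs with ▷-pick p rs
  ... | _ , _ , p' , r , rs' with ▷-↘ r o
  ...   | inj₂ g = wins-pick p' (eager⇒wins g)
  ...   | inj₁ (_ , o' , ▷-tauP r') = _ , w-tau p' o' (proj₂ (▷-win w (r' ∷ rs')))
  ▷-win (w-com {y = y} p q o₁ o₂ w) rs with ▷-pick p rs
  ... | _ , _ , p' , r₁ , rs' with ▷-pick q rs'
  ...   | _ , _ , q' , r₂ , rs'' with ▷-↘ r₁ o₁ | ▷-↘ r₂ o₂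
  ...     | inj₂ g | _ = wins-pick p' (eager⇒wins g)
  ...     | inj₁ _ | inj₂ g with pick-swap p' q'
  ...       | _ , q'' , _ = wins-pick q'' (eager⇒wins g)
  ▷-win (w-com {y = y} p q o₁ o₂ w) rs | _ , _ , p' , r₁ , rs' | _ , _ , q' , r₂ , rs''
    | inj₁ (_ , o₁' , ▷-inpP r₁') | inj₁ (_ , o₂' , ▷-outP r₂') =
    _ , w-com p' q' o₁' o₂' (proj₂ (▷-win w (▷-rename (sub0N y) r₁' ∷ r₂' ∷ rs'')))

  ▷-reach : {P Q : Target} → P ▷ Q → ReachesSuccess P → ReachesSuccess Q
  ▷-reach r s with reach⇒wins s
  ... | _ , w = reach-≡ₛ (sym≡ par-unit) (wins⇒reach (proj₂ (▷-win w (r ∷ []))))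

  ▷-fill : ∀ {k} (C : Ctx false k) {S S' : Fin k → Target} → (∀ i → S i ▷ S' i) →
    fill C S ▷ fill C S'
  ▷-fill (hole i) h = h i
  ▷-fill nil h = ▷-nil
  ▷-fill (inp x z C) h = ▷-inp (▷-rename (closeN z) (▷-fill C h))
  ▷-fill (out x y C) h = ▷-out (▷-fill C h)
  ▷-fill (tau C) h = ▷-tau (▷-fill C h)
  ▷-fill (sum C D) h = ▷-sum (▷-fill C h) (▷-fill D h)
  ▷-fill (par C D) h = ▷-par (▷-fill C h) (▷-fill D h)
  ▷-fill (new z C) h = ▷-new (▷-rename (closeN z) (▷-fill C h))
  ▷-fill (bang C) h = ▷-bang (▷-fill C h)
  ▷-fill ok h = ▷-ok

  ▷-refl : (P : Proc false n) → P ▷ P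
  ▷-refl nil = ▷-nil
  ▷-refl (inp x P) = ▷-inp (▷-refl P)
  ▷-refl (out x y P) = ▷-out (▷-refl P)
  ▷-refl (tau P) = ▷-tau (▷-refl P)
  ▷-refl (P ⊕ Q) = ▷-sum (▷-refl P) (▷-refl Q)
  ▷-refl (P ∥ Q) = ▷-par (▷-refl P) (▷-refl Q)
  ▷-refl (new P) = ▷-new (▷-refl P)
  ▷-refl (bang P) = ▷-bang (▷-refl P)
  ▷-refl ok = ▷-ok

-- Predicates of filled contexts

Slots : (Target → Set) → ∀ {k} → Ctx false k → (Fin k → Target) → Set
Slots F C S = (∀ S' → F (fill C S')) ⊎ (∃[ i ] (F (S i) × (∀ S' → F (S' i) → F (fill C S'))))

-- A linear predicate of fill C S is a disjunction of some of the F (S i), or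
-- always true; it cannot express that two components have a property jointly.
record Linear (F : Target → Set) : Set where
  constructor linear
  field slots : ∀ {k} (C : Ctx false k) S → F (fill C S) → Slots F C S

open Linear

slots-map : ∀ (F : Target → Set) {k} (C D : Ctx false k) S →
  (∀ S' → F (fill C S') → F (fill D S')) → Slots F C S → Slots F D S
slots-map F C D S f (inj₁ h) = inj₁ (λ S' → f S' (h S'))
slots-map F C D S f (inj₂ (i , q , h)) = inj₂ (i , q , λ S' q' → f S' (h S' q'))

ok-slots : ∀ {k} (C : Ctx false k) S → Unguarded✓ (fill C S) → Slots Unguarded✓ C S
ok-slots (hole i) S q = inj₂ (i , q , λ _ → id)
ok-slots (sum C D) S (inj₁ q) = slots-map Unguarded✓ C (sum C D) S (λ _ → inj₁) (ok-slots C S q)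
ok-slots (sum C D) S (inj₂ q) = slots-map Unguarded✓ D (sum C D) S (λ _ → inj₂) (ok-slots D S q)
ok-slots (par C D) S (inj₁ q) = slots-map Unguarded✓ C (par C D) S (λ _ → inj₁) (ok-slots C S q)
ok-slots (par C D) S (inj₂ q) = slots-map Unguarded✓ D (par C D) S (λ _ → inj₂) (ok-slots D S q)
ok-slots (new z C) S q =
  slots-map Unguarded✓ C (new z C) S (λ S' → Equivalence.from (Ok-rename (closeN z) (fill C S')))
    (ok-slots C S (Equivalence.to (Ok-rename (closeN z) (fill C S)) q))
ok-slots (bang C) S q = slots-map Unguarded✓ C (bang C) S (λ _ → id) (ok-slots C S q)
ok-slots ok S q = inj₁ (λ _ → q)

act-slots : ∀ {k} (C : Ctx false k) S → Act (fill C S) → Slots Act C S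
act-slots (hole i) S q = inj₂ (i , q , λ _ → id)
act-slots (inp _ _ _) S q = inj₁ (λ _ → tt)
act-slots (out _ _ _) S q = inj₁ (λ _ → tt)
act-slots (tau _) S q = inj₁ (λ _ → tt)
act-slots (sum C D) S (inj₁ q) = slots-map Act C (sum C D) S (λ _ → inj₁) (act-slots C S q)
act-slots (sum C D) S (inj₂ q) = slots-map Act D (sum C D) S (λ _ → inj₂) (act-slots D S q)
act-slots (par C D) S (inj₁ q) = slots-map Act C (par C D) S (λ _ → inj₁) (act-slots C S q)
act-slots (par C D) S (inj₂ q) = slots-map Act D (par C D) S (λ _ → inj₂) (act-slots D S q)
act-slots (new z C) S q =
  slots-map Act C (new z C) S (λ S' → Equivalence.from (Act-rename (closeN z) (fill C S')))
    (act-slots C S (Equivalence.to (Act-rename (closeN z) (fill C S)) q))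
act-slots (bang _) S q = inj₁ (λ _ → tt)
act-slots ok S q = inj₁ (λ _ → q)

module _ {a : ℕ} {G : Set} where
  free-wkN : (x : Nm n) → FreeInN a (wkN x) → FreeInN a x
  free-wkN (fr _) q = q

  free-ext : {ρ : Nm n → Nm j} → (∀ x → FreeInN a (ρ x) → FreeInN a x × G) →
    ∀ x → FreeInN a (ext ρ x) → FreeInN a x × G
  free-ext {ρ = ρ} h (bd (suc i)) q = h (bd i) (free-wkN (ρ (bd i)) q)
  free-ext {ρ = ρ} h (fr b) q = h (fr b) (free-wkN (ρ (fr b)) q)

  -- G records what the survival of a single occurrence reveals about ρ; for `closeN z` it is a ≢ z.
  free-rename⁻ : {ρ : Nm n → Nm j} → (∀ x → FreeInN a (ρ x) → FreeInN a x × G) →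
    (P : Proc m n) → FreeIn a (rename ρ P) → FreeIn a P × G
  free-rename⁻ h (inp x P) (inj₁ q) = let (q' , g) = h x q in inj₁ q' , g
  free-rename⁻ h (inp x P) (inj₂ q) = let (q' , g) = free-rename⁻ (free-ext h) P q in inj₂ q' , g
  free-rename⁻ h (out x y P) (inj₁ q) = let (q' , g) = h x q in inj₁ q' , g
  free-rename⁻ h (out x y P) (inj₂ (inj₁ q)) = let (q' , g) = h y q in inj₂ (inj₁ q') , g
  free-rename⁻ h (out x y P) (inj₂ (inj₂ q)) =
    let (q' , g) = free-rename⁻ h P q in inj₂ (inj₂ q') , g
  free-rename⁻ h (tau P) q = free-rename⁻ h P q
  free-rename⁻ h (mat _ x y P) (inj₁ q) = let (q' , g) = h x q in inj₁ q' , g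
  free-rename⁻ h (mat _ x y P) (inj₂ (inj₁ q)) = let (q' , g) = h y q in inj₂ (inj₁ q') , g
  free-rename⁻ h (mat _ x y P) (inj₂ (inj₂ q)) =
    let (q' , g) = free-rename⁻ h P q in inj₂ (inj₂ q') , g
  free-rename⁻ h (P ⊕ Q) (inj₁ q) = let (q' , g) = free-rename⁻ h P q in inj₁ q' , g
  free-rename⁻ h (P ⊕ Q) (inj₂ q) = let (q' , g) = free-rename⁻ h Q q in inj₂ q' , g
  free-rename⁻ h (P ∥ Q) (inj₁ q) = let (q' , g) = free-rename⁻ h P q in inj₁ q' , g
  free-rename⁻ h (P ∥ Q) (inj₂ q) = let (q' , g) = free-rename⁻ h Q q in inj₂ q' , g
  free-rename⁻ h (new P) q = free-rename⁻ (free-ext h) P q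
  free-rename⁻ h (bang P) q = free-rename⁻ h P q

free-name : {ρ : Nm n → Nm j} {a : ℕ} → FreeInN a (ρ (fr a)) → (x : Nm n) → FreeInN a x → FreeInN a (ρ x)
free-name h (fr _) refl = h

free-rename : {ρ : Nm n → Nm j} {a : ℕ} → FreeInN a (ρ (fr a)) → (P : Proc false n) →
  FreeIn a P → FreeIn a (rename ρ P)
free-rename {ρ = ρ} {a} h = go h
  where
  wk-free : (x : Nm l) → FreeInN a x → FreeInN a (wkN x)
  wk-free (fr _) q = q

  go : ∀ {n j} {ρ : Nm n → Nm j} → FreeInN a (ρ (fr a)) → (P : Proc false n) →
    FreeIn a P → FreeIn a (rename ρ P)
  go {ρ = ρ} h (inp x P) (inj₁ q) = inj₁ (free-name {ρ = ρ} h x q)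
  go h (inp x P) (inj₂ q) = inj₂ (go (wk-free _ h) P q)
  go {ρ = ρ} h (out x y P) (inj₁ q) = inj₁ (free-name {ρ = ρ} h x q)
  go {ρ = ρ} h (out x y P) (inj₂ (inj₁ q)) = inj₂ (inj₁ (free-name {ρ = ρ} h y q))
  go h (out x y P) (inj₂ (inj₂ q)) = inj₂ (inj₂ (go h P q))
  go h (tau P) q = go h P q
  go h (P ⊕ Q) = Sum.map (go h P) (go h Q)
  go h (P ∥ Q) = Sum.map (go h P) (go h Q)
  go h (new P) q = go (wk-free _ h) P q
  go h (bang P) q = go h P q

free-closeN⁻ : ∀ {a} z (x : Nm n) → FreeInN a (closeN z x) → FreeInN a x × a ≢ z
free-closeN⁻ z (fr b) q with b ≡ᵇ z in eq
free-closeN⁻ z (fr b) refl | false = refl , λ { refl → subst T eq (≡⇒≡ᵇ b b refl) }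

free-closeN : ∀ {a} z → a ≢ z → FreeInN a (closeN {n} z (fr a))
free-closeN {a = a} z h with a ≡ᵇ z in eq
... | false = refl
... | true = h (≡ᵇ⇒≡ a z (subst T (sym eq) tt))

free-close : ∀ {a} z (P : Term false) → FreeIn a (close z P) ⇔ (FreeIn a P × a ≢ z)
free-close z P = mk⇔ (free-rename⁻ (free-closeN⁻ z) P)
  (λ (q , h) → free-rename (free-closeN z h) P q)

free-slots : ∀ a {k} (C : Ctx false k) S → FreeIn a (fill C S) → Slots (FreeIn a) C S
free-slots a (hole i) S q = inj₂ (i , q , λ _ → id)
free-slots a (inp x z C) S (inj₁ q) = inj₁ (λ _ → inj₁ q)
free-slots a (inp x z C) S (inj₂ q) = let (q' , h) = Equivalence.to (free-close z (fill C S)) q in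
  slots-map (FreeIn a) C (inp x z C) S
    (λ S' q'' → inj₂ (Equivalence.from (free-close z (fill C S')) (q'' , h))) (free-slots a C S q')
free-slots a (out x y C) S (inj₁ q) = inj₁ (λ _ → inj₁ q)
free-slots a (out x y C) S (inj₂ (inj₁ q)) = inj₁ (λ _ → inj₂ (inj₁ q))
free-slots a (out x y C) S (inj₂ (inj₂ q)) =
  slots-map (FreeIn a) C (out x y C) S (λ _ → inj₂ ∘ inj₂) (free-slots a C S q)
free-slots a (tau C) S q = slots-map (FreeIn a) C (tau C) S (λ _ → id) (free-slots a C S q)
free-slots a (sum C D) S (inj₁ q) = slots-map (FreeIn a) C (sum C D) S (λ _ → inj₁) (free-slots a C S q)
free-slots a (sum C D) S (inj₂ q) = slots-map (FreeIn a) D (sum C D) S (λ _ → inj₂) (free-slots a D S q)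
free-slots a (par C D) S (inj₁ q) = slots-map (FreeIn a) C (par C D) S (λ _ → inj₁) (free-slots a C S q)
free-slots a (par C D) S (inj₂ q) = slots-map (FreeIn a) D (par C D) S (λ _ → inj₂) (free-slots a D S q)
free-slots a (new z C) S q = let (q' , h) = Equivalence.to (free-close z (fill C S)) q in
  slots-map (FreeIn a) C (new z C) S
    (λ S' q'' → Equivalence.from (free-close z (fill C S')) (q'' , h)) (free-slots a C S q')
free-slots a (bang C) S q = slots-map (FreeIn a) C (bang C) S (λ _ → id) (free-slots a C S q)

ok-linear : Linear Unguarded✓
ok-linear = linear ok-slots

act-linear : Linear Act
act-linear = linear act-slots

free-linear : ∀ a → Linear (FreeIn a)
free-linear a = linear (free-slots a)

module _ {F : Target → Set} (lin : Linear F) where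
  linear-mono : ∀ {k} (C : Ctx false k) {S S'} → (∀ i → F (S i) → F (S' i)) →
    F (fill C S) → F (fill C S')
  linear-mono C {S} {S'} h q with slots lin C S q
  ... | inj₁ c = c S'
  ... | inj₂ (i , q' , c) = c S' (h i q')

  -- Applied with C S' as second component of S'', this passes from C(x, y) to C(x, C(e, y)): if C
  -- transmits F from its second hole, it does so twice.
  linear-insert : (C : Ctx false 2) {S S' S'' : Fin 2 → Target} →
    (F (S zero) → F (S'' zero)) → (F (S (suc zero)) → F (S' (suc zero))) →
    (F (fill C S') → F (S'' (suc zero))) → F (fill C S) → F (fill C S'')
  linear-insert C {S} {S'} {S''} h₀ h₁ h₂ q with slots lin C S q
  ... | inj₁ c = c S''
  ... | inj₂ (zero , q' , c) = c S'' (h₀ q')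
  ... | inj₂ (suc zero , q' , c) = c S'' (h₂ (c S' (h₁ q')))

  -- The way back from C(x, C(e, y)) to C(x, y): as e lacks F, it cannot be the source of F.
  linear-remove : (C : Ctx false 2) {S S' S'' : Fin 2 → Target} →
    (F (S'' zero) → F (S zero)) → ¬ F (S' zero) → (F (S' (suc zero)) → F (S (suc zero))) →
    (F (S'' (suc zero)) → F (fill C S')) → F (fill C S'') → F (fill C S)
  linear-remove C {S} {S'} {S''} h₀ n h₁ h₂ q with slots lin C S'' q
  ... | inj₁ c = c S
  ... | inj₂ (zero , q' , c) = c S (h₀ q')
  ... | inj₂ (suc zero , q' , c) with slots lin C S' (h₂ q')
  ...   | inj₁ c' = c' S
  ...   | inj₂ (zero , q'' , _) = ⊥-elim (n q'')
  ...   | inj₂ (suc zero , q'' , c') = c' S (h₁ q'')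

  -- Idempotence of disjunction: C(x, C(x, y)) has F only if C(x, y) has.
  linear-merge : (C : Ctx false 2) {S S' : Fin 2 → Target} →
    (F (S' zero) → F (S zero)) → (F (S' (suc zero)) → F (fill C S)) → F (fill C S') → F (fill C S)
  linear-merge C {S} {S'} h₀ h₁ q with slots lin C S' q
  ... | inj₁ c = c S
  ... | inj₂ (zero , q' , c) = c S (h₀ q')
  ... | inj₂ (suc zero , q' , _) = h₁ q'

-- A syntactic invariant of source terms that never reach success

private variable
  B C D I₁ I₂ I₃ M₁ M₂ M₃ D₁ D₂ D₃ I₁' I₂' M₁' M₂' D₁' D₂' : Set

Env : ℕ → Set
Env n = Nm n → ℕ

infixl 5 _▸_
_▸_ : Env n → ℕ → Env (suc n)
(ρ ▸ v) (bd zero) = v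
(ρ ▸ v) (bd (suc i)) = ρ (bd i)
(ρ ▸ v) (fr a) = ρ (fr a)

-- top: not in a sum; summand: in a sum with an active other side;
-- blocked: inside a parallel composition that is a summand, unable to act.
data Mode : Set where
  top summand blocked : Mode

in-par in-sum : Mode → Mode
in-par top = top
in-par summand = blocked
in-par blocked = blocked
in-sum top = summand
in-sum summand = summand
in-sum blocked = blocked

Guarded : Mode → Set → Set
Guarded blocked _ = ⊤
Guarded _ A = A

Inertₛ : Env n → Proc true n → Set
Inertₛ ρ nil = ⊤
Inertₛ ρ (inp _ _) = ⊥
Inertₛ ρ (out _ _ _) = ⊥
Inertₛ ρ (tau _) = ⊥
Inertₛ ρ (mat _ a b P) = ρ a ≡ ρ b × Inertₛ ρ P
Inertₛ ρ (P ⊕ Q) = Inertₛ ρ P × Inertₛ ρ Q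
Inertₛ ρ (P ∥ Q) = Inertₛ ρ P × Inertₛ ρ Q
Inertₛ ρ (new P) = ∃[ v ] Inertₛ (ρ ▸ v) P
Inertₛ ρ (bang _) = ⊥
Inertₛ ρ ok = ⊥

-- Bound names are quantified over all values, so a term is safe only if it
-- stays safe under every identification of them.
Safe : Mode → Env n → Proc true n → Set
Safe μ ρ nil = ⊤
Safe μ ρ (inp x P) = Guarded μ (∀ v → Safe top (ρ ▸ v) P)
Safe μ ρ (out x y P) = Guarded μ (Safe top ρ P)
Safe μ ρ (tau P) = Guarded μ (Safe top ρ P)
Safe μ ρ (mat _ a b P) = ρ a ≡ ρ b → Safe μ ρ P
Safe μ ρ (P ⊕ Q) = Safe (in-sum μ) ρ P × Safe (in-sum μ) ρ Q ×
  (Inertₛ ρ P → Safe μ ρ Q) × (Inertₛ ρ Q → Safe μ ρ P)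
Safe μ ρ (P ∥ Q) = Safe (in-par μ) ρ P × Safe (in-par μ) ρ Q ×
  (Inertₛ ρ P → Safe μ ρ Q) × (Inertₛ ρ Q → Safe μ ρ P)
Safe μ ρ (new P) = ∀ v → Safe μ (ρ ▸ v) P
Safe μ ρ (bang P) = Safe (in-par μ) ρ P
Safe μ ρ ok = ⊥

-- The modes are ordered: fewer ways to act leave fewer obligations.
safe-summand : {ρ : Env n} (P : Proc true n) → Safe top ρ P → Safe summand ρ P
safe-blocked : {ρ : Env n} (P : Proc true n) → Safe summand ρ P → Safe blocked ρ P

safe-summand nil s = tt
safe-summand (inp x P) s = s
safe-summand (out x y P) s = s
safe-summand (tau P) s = s
safe-summand (mat _ a b P) s e = safe-summand P (s e)
safe-summand (P ⊕ Q) (p , q , f , g) = p , q , (λ _ → q) , (λ _ → p)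
safe-summand (P ∥ Q) (p , q , f , g) =
  safe-blocked P (safe-summand P p) , safe-blocked Q (safe-summand Q q) ,
  (λ _ → safe-summand Q q) , (λ _ → safe-summand P p)
safe-summand (new P) s v = safe-summand P (s v)
safe-summand (bang P) s = safe-blocked P (safe-summand P s)

safe-blocked nil s = tt
safe-blocked (inp x P) s = tt
safe-blocked (out x y P) s = tt
safe-blocked (tau P) s = tt
safe-blocked (mat _ a b P) s e = safe-blocked P (s e)
safe-blocked (P ⊕ Q) (p , q , _ , _) =
  safe-blocked P p , safe-blocked Q q , (λ _ → safe-blocked Q q) , (λ _ → safe-blocked P p)
safe-blocked (P ∥ Q) (p , q , _ , _) = p , q , (λ _ → q) , (λ _ → p)
safe-blocked (new P) s v = safe-blocked P (s v)
safe-blocked (bang P) s = s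

safe-in-par : ∀ μ {ρ : Env n} (P : Proc true n) → Safe μ ρ P → Safe (in-par μ) ρ P
safe-in-par top P s = s
safe-in-par summand P s = safe-blocked P s
safe-in-par blocked P s = s

safe-in-sum : ∀ μ {ρ : Env n} (P : Proc true n) → Safe μ ρ P → Safe (in-sum μ) ρ P
safe-in-sum top P s = safe-summand P s
safe-in-sum summand P s = s
safe-in-sum blocked P s = s

→-⇔ : A ⇔ B → C ⇔ D → (A → C) ⇔ (B → D)
→-⇔ e f = mk⇔ (λ h → Equivalence.to f ∘ h ∘ Equivalence.from e)
              (λ h → Equivalence.from f ∘ h ∘ Equivalence.to e)

Π-⇔ : {F G : ℕ → Set} → (∀ v → F v ⇔ G v) → (∀ v → F v) ⇔ (∀ v → G v)
Π-⇔ h = mk⇔ (λ f v → Equivalence.to (h v) (f v)) (λ f v → Equivalence.from (h v) (f v))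

∃-⇔ : {F G : ℕ → Set} → (∀ v → F v ⇔ G v) → ∃ F ⇔ ∃ G
∃-⇔ h = mk⇔ (λ (v , q) → v , Equivalence.to (h v) q) (λ (v , q) → v , Equivalence.from (h v) q)

guarded-⇔ : ∀ μ → A ⇔ B → Guarded μ A ⇔ Guarded μ B
guarded-⇔ top e = e
guarded-⇔ summand e = e
guarded-⇔ blocked e = ⇔-refl

Both : (D₁ D₂ I₁ I₂ M₁ M₂ : Set) → Set
Both D₁ D₂ I₁ I₂ M₁ M₂ = D₁ × D₂ × (I₁ → M₂) × (I₂ → M₁)

both-⇔ : D₁ ⇔ D₁' → D₂ ⇔ D₂' → I₁ ⇔ I₁' → I₂ ⇔ I₂' → M₁ ⇔ M₁' → M₂ ⇔ M₂' →
  Both D₁ D₂ I₁ I₂ M₁ M₂ ⇔ Both D₁' D₂' I₁' I₂' M₁' M₂'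
both-⇔ d₁ d₂ i₁ i₂ m₁ m₂ = ×-⇔ d₁ (×-⇔ d₂ (×-⇔ (→-⇔ i₁ m₂) (→-⇔ i₂ m₁)))

both-comm : Both D₁ D₂ I₁ I₂ M₁ M₂ ⇔ Both D₂ D₁ I₂ I₁ M₂ M₁
both-comm = mk⇔ (λ (p , q , f , g) → q , p , g , f) (λ (p , q , f , g) → q , p , g , f)

both-unit : (M₁ → D₁) → Both D₁ ⊤ I₁ ⊤ M₁ ⊤ ⇔ M₁
both-unit h = mk⇔ (λ (_ , _ , _ , g) → g tt) (λ m → h m , tt , (λ _ → tt) , (λ _ → m))

-- The inner `Both` repeats D₁ and D₂ because `in-par` and `in-sum` are idempotent: inside a
-- composition the mode no longer changes.
both-assoc :
  Both (Both D₁ D₂ I₁ I₂ D₁ D₂) D₃ (I₁ × I₂) I₃ (Both D₁ D₂ I₁ I₂ M₁ M₂) M₃ ⇔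
  Both D₁ (Both D₂ D₃ I₂ I₃ D₂ D₃) I₁ (I₂ × I₃) M₁ (Both D₂ D₃ I₂ I₃ M₂ M₃)
both-assoc = mk⇔
  (λ ((p , q , _ , _) , r , f , g) → p , (q , r , (λ _ → r) , (λ _ → q)) ,
    (λ i → q , r , (λ j → f (i , j)) , (λ k → proj₁ (proj₂ (proj₂ (g k))) i)) ,
    (λ (j , k) → proj₂ (proj₂ (proj₂ (g k))) j))
  (λ (p , (q , r , _ , _) , f , g) → (p , q , (λ _ → q) , (λ _ → p)) , r ,
    (λ (i , j) → proj₁ (proj₂ (proj₂ (f i))) j) ,
    (λ k → p , q , (λ i → proj₂ (proj₂ (proj₂ (f i))) k) , (λ j → g (j , k))))

▸-wk : {ρ : Env n} {v : ℕ} → ∀ x → (ρ ▸ v) (wkN x) ≡ ρ x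
▸-wk (bd _) = refl
▸-wk (fr _) = refl

▸-ext : {ρ : Env j} {θ : Nm n → Nm j} {ζ : Env n} → (∀ x → ρ (θ x) ≡ ζ x) →
  ∀ v x → (ρ ▸ v) (ext θ x) ≡ (ζ ▸ v) x
▸-ext h v (bd zero) = refl
▸-ext {θ = θ} h v (bd (suc i)) = trans (▸-wk (θ (bd i))) (h (bd i))
▸-ext {θ = θ} h v (fr a) = trans (▸-wk (θ (fr a))) (h (fr a))

≡-⇔ : {a a' b b' : ℕ} → a ≡ a' → b ≡ b' → (a ≡ b) ⇔ (a' ≡ b')
≡-⇔ refl refl = ⇔-refl

inertₛ-rename : {ρ : Env j} {θ : Nm n → Nm j} {ζ : Env n} → (∀ x → ρ (θ x) ≡ ζ x) →
  (P : Proc true n) → Inertₛ ρ (rename θ P) ⇔ Inertₛ ζ P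
inertₛ-rename h nil = ⇔-refl
inertₛ-rename h (inp _ _) = ⇔-refl
inertₛ-rename h (out _ _ _) = ⇔-refl
inertₛ-rename h (tau _) = ⇔-refl
inertₛ-rename h (mat _ a b P) = ×-⇔ (≡-⇔ (h a) (h b)) (inertₛ-rename h P)
inertₛ-rename h (P ⊕ Q) = ×-⇔ (inertₛ-rename h P) (inertₛ-rename h Q)
inertₛ-rename h (P ∥ Q) = ×-⇔ (inertₛ-rename h P) (inertₛ-rename h Q)
inertₛ-rename h (new P) = ∃-⇔ (λ v → inertₛ-rename (▸-ext h v) P)
inertₛ-rename h (bang _) = ⇔-refl
inertₛ-rename h ok = ⇔-refl

safe-rename : ∀ μ {ρ : Env j} {θ : Nm n → Nm j} {ζ : Env n} → (∀ x → ρ (θ x) ≡ ζ x) →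
  (P : Proc true n) → Safe μ ρ (rename θ P) ⇔ Safe μ ζ P
safe-rename μ h nil = ⇔-refl
safe-rename μ h (inp _ P) = guarded-⇔ μ (Π-⇔ (λ v → safe-rename top (▸-ext h v) P))
safe-rename μ h (out _ _ P) = guarded-⇔ μ (safe-rename top h P)
safe-rename μ h (tau P) = guarded-⇔ μ (safe-rename top h P)
safe-rename μ h (mat _ a b P) = →-⇔ (≡-⇔ (h a) (h b)) (safe-rename μ h P)
safe-rename μ h (P ⊕ Q) = both-⇔ (safe-rename _ h P) (safe-rename _ h Q)
  (inertₛ-rename h P) (inertₛ-rename h Q) (safe-rename μ h P) (safe-rename μ h Q)
safe-rename μ h (P ∥ Q) = both-⇔ (safe-rename _ h P) (safe-rename _ h Q)
  (inertₛ-rename h P) (inertₛ-rename h Q) (safe-rename μ h P) (safe-rename μ h Q)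
safe-rename μ h (new P) = Π-⇔ (λ v → safe-rename μ (▸-ext h v) P)
safe-rename μ h (bang P) = safe-rename _ h P
safe-rename μ h ok = ⇔-refl

▸-swap : {ρ : Env n} {v w : ℕ} → ∀ x → (ρ ▸ v ▸ w) (swapN x) ≡ (ρ ▸ w ▸ v) x
▸-swap (bd zero) = refl
▸-swap (bd (suc zero)) = refl
▸-swap (bd (suc (suc i))) = refl
▸-swap (fr a) = refl

▸-sub0 : {ρ : Env n} {y : Nm n} → ∀ x → ρ (sub0N y x) ≡ (ρ ▸ ρ y) x
▸-sub0 (bd zero) = refl
▸-sub0 (bd (suc i)) = refl
▸-sub0 (fr a) = refl

inertₛ-≡ₛ : {P Q : Proc true n} → P ≡ₛ Q → (ρ : Env n) → Inertₛ ρ P ⇔ Inertₛ ρ Q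
inertₛ-≡ₛ refl≡ ρ = ⇔-refl
inertₛ-≡ₛ (sym≡ e) ρ = ⇔-sym (inertₛ-≡ₛ e ρ)
inertₛ-≡ₛ (trans≡ e f) ρ = ⇔-trans (inertₛ-≡ₛ e ρ) (inertₛ-≡ₛ f ρ)
inertₛ-≡ₛ (c-inp _) ρ = ⇔-refl
inertₛ-≡ₛ (c-out _) ρ = ⇔-refl
inertₛ-≡ₛ (c-tau _) ρ = ⇔-refl
inertₛ-≡ₛ (c-mat e) ρ = ×-⇔ ⇔-refl (inertₛ-≡ₛ e ρ)
inertₛ-≡ₛ (c-sumˡ e) ρ = ×-⇔ (inertₛ-≡ₛ e ρ) ⇔-refl
inertₛ-≡ₛ (c-sumʳ e) ρ = ×-⇔ ⇔-refl (inertₛ-≡ₛ e ρ)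
inertₛ-≡ₛ (c-parˡ e) ρ = ×-⇔ (inertₛ-≡ₛ e ρ) ⇔-refl
inertₛ-≡ₛ (c-parʳ e) ρ = ×-⇔ ⇔-refl (inertₛ-≡ₛ e ρ)
inertₛ-≡ₛ (c-new e) ρ = ∃-⇔ (λ v → inertₛ-≡ₛ e (ρ ▸ v))
inertₛ-≡ₛ (c-bang _) ρ = ⇔-refl
inertₛ-≡ₛ par-unit ρ = mk⇔ proj₁ (_, tt)
inertₛ-≡ₛ par-comm ρ = mk⇔ Product.swap Product.swap
inertₛ-≡ₛ par-assoc ρ = mk⇔ Product.assocʳ Product.assocˡ
inertₛ-≡ₛ sum-unit ρ = mk⇔ proj₁ (_, tt)
inertₛ-≡ₛ sum-comm ρ = mk⇔ Product.swap Product.swap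
inertₛ-≡ₛ sum-assoc ρ = mk⇔ Product.assocʳ Product.assocˡ
inertₛ-≡ₛ new-nil ρ = mk⇔ (λ _ → tt) (λ _ → 0 , tt)
inertₛ-≡ₛ (new-swap {P = P}) ρ = mk⇔
  (λ (v , w , i) → w , v , Equivalence.from (inertₛ-rename ▸-swap P) i)
  (λ (v , w , i) → w , v , Equivalence.to (inertₛ-rename ▸-swap P) i)
inertₛ-≡ₛ (new-par {P = P}) ρ = mk⇔
  (λ (v , p , q) → Equivalence.to (inertₛ-rename ▸-wk P) p , v , q)
  (λ (p , v , q) → v , Equivalence.from (inertₛ-rename ▸-wk P) p , q)
inertₛ-≡ₛ bang-unf ρ = mk⇔ (λ ()) proj₂
inertₛ-≡ₛ mat-refl ρ = mk⇔ proj₂ (refl ,_)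

safe-≡ₛ : {P Q : Proc true n} → P ≡ₛ Q → ∀ μ (ρ : Env n) → Safe μ ρ P ⇔ Safe μ ρ Q
safe-≡ₛ refl≡ μ ρ = ⇔-refl
safe-≡ₛ (sym≡ e) μ ρ = ⇔-sym (safe-≡ₛ e μ ρ)
safe-≡ₛ (trans≡ e f) μ ρ = ⇔-trans (safe-≡ₛ e μ ρ) (safe-≡ₛ f μ ρ)
safe-≡ₛ (c-inp e) μ ρ = guarded-⇔ μ (Π-⇔ (λ v → safe-≡ₛ e top (ρ ▸ v)))
safe-≡ₛ (c-out e) μ ρ = guarded-⇔ μ (safe-≡ₛ e top ρ)
safe-≡ₛ (c-tau e) μ ρ = guarded-⇔ μ (safe-≡ₛ e top ρ)
safe-≡ₛ (c-mat e) μ ρ = →-⇔ ⇔-refl (safe-≡ₛ e μ ρ)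
safe-≡ₛ (c-sumˡ e) μ ρ = both-⇔ (safe-≡ₛ e _ ρ) ⇔-refl (inertₛ-≡ₛ e ρ) ⇔-refl (safe-≡ₛ e μ ρ) ⇔-refl
safe-≡ₛ (c-sumʳ e) μ ρ = both-⇔ ⇔-refl (safe-≡ₛ e _ ρ) ⇔-refl (inertₛ-≡ₛ e ρ) ⇔-refl (safe-≡ₛ e μ ρ)
safe-≡ₛ (c-parˡ e) μ ρ = both-⇔ (safe-≡ₛ e _ ρ) ⇔-refl (inertₛ-≡ₛ e ρ) ⇔-refl (safe-≡ₛ e μ ρ) ⇔-refl
safe-≡ₛ (c-parʳ e) μ ρ = both-⇔ ⇔-refl (safe-≡ₛ e _ ρ) ⇔-refl (inertₛ-≡ₛ e ρ) ⇔-refl (safe-≡ₛ e μ ρ)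
safe-≡ₛ (c-new e) μ ρ = Π-⇔ (λ v → safe-≡ₛ e μ (ρ ▸ v))
safe-≡ₛ (c-bang e) μ ρ = safe-≡ₛ e _ ρ
safe-≡ₛ (par-unit {P = P}) μ ρ = both-unit (safe-in-par μ P)
safe-≡ₛ par-comm μ ρ = both-comm
-- Case analysis on the mode makes this idempotence definitional.
safe-≡ₛ par-assoc top ρ = both-assoc
safe-≡ₛ par-assoc summand ρ = both-assoc
safe-≡ₛ par-assoc blocked ρ = both-assoc
safe-≡ₛ (sum-unit {P = P}) μ ρ = both-unit (safe-in-sum μ P)
safe-≡ₛ sum-comm μ ρ = both-comm
safe-≡ₛ sum-assoc top ρ = both-assoc
safe-≡ₛ sum-assoc summand ρ = both-assoc
safe-≡ₛ sum-assoc blocked ρ = both-assoc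
safe-≡ₛ new-nil μ ρ = mk⇔ (λ _ → tt) (λ _ _ → tt)
safe-≡ₛ (new-swap {P = P}) μ ρ = mk⇔
  (λ s v w → Equivalence.from (safe-rename μ ▸-swap P) (s w v))
  (λ s v w → Equivalence.to (safe-rename μ ▸-swap P) (s w v))
safe-≡ₛ (new-par {P = P} {Q}) μ ρ = mk⇔
  -- P does not contain the bound name, so any value serves.
  (λ s → Equivalence.to (safe-rename _ ▸-wk P) (proj₁ (s 0)) ,
    (λ v → proj₁ (proj₂ (s v))) ,
    (λ i v → proj₁ (proj₂ (proj₂ (s v))) (Equivalence.from (inertₛ-rename ▸-wk P) i)) ,
    (λ (v , i) → Equivalence.to (safe-rename μ ▸-wk P) (proj₂ (proj₂ (proj₂ (s v))) i)))
  (λ (p , q , f , g) v →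
    Equivalence.from (safe-rename _ ▸-wk P) p , q v ,
    (λ i → f (Equivalence.to (inertₛ-rename ▸-wk P) i) v) ,
    (λ i → Equivalence.from (safe-rename μ ▸-wk P) (g (v , i))))
safe-≡ₛ bang-unf top ρ = mk⇔ (λ s → s , s , (λ _ → s) , (λ ())) proj₁
safe-≡ₛ bang-unf summand ρ = mk⇔ (λ s → s , s , (λ _ → s) , (λ ())) proj₁
safe-≡ₛ bang-unf blocked ρ = mk⇔ (λ s → s , s , (λ _ → s) , (λ ())) proj₁
safe-≡ₛ mat-refl μ ρ = mk⇔ (λ s → s refl) (λ s _ → s)

-- In `r-com` the input is a direct summand, where `Guarded` keeps the condition on its
-- continuation; the quantifier over values is instantiated at ρ y.
safe-step : {P Q : Proc true n} → P ⟶ Q → (ρ : Env n) → Safe top ρ P → Safe top ρ Q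
safe-step (r-com {y = y} {P = P}) ρ ((p , _) , (q , _) , _) =
  p' , q , (λ _ → q) , (λ _ → p')
  where
  p' : Safe top ρ (P [ y ])
  p' = Equivalence.from (safe-rename top ▸-sub0 P) (p (ρ y))
safe-step r-tau ρ (p , _) = p
safe-step (r-par s) ρ (p , q , _ , _) = safe-step s ρ p , q , (λ _ → q) , (λ _ → safe-step s ρ p)
safe-step (r-new s) ρ p v = safe-step s (ρ ▸ v) (p v)
safe-step (r-struc e s f) ρ p = Equivalence.to (safe-≡ₛ f top ρ)
  (safe-step s ρ (Equivalence.to (safe-≡ₛ e top ρ) p))

-- Even in the weakest mode ✓ is unsafe, and names that are syntactically equal have equal values
-- under ρ.
safe-not-ok : {ρ : Env n} (P : Proc true n) → Safe blocked ρ P → ¬ Unguarded✓ P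
safe-not-ok {ρ = ρ} (mat _ a b P) s (e , u) = safe-not-ok P (s (cong ρ e)) u
safe-not-ok (P ⊕ Q) (p , q , _) = [ safe-not-ok P p , safe-not-ok Q q ]′
safe-not-ok (P ∥ Q) (p , q , _) = [ safe-not-ok P p , safe-not-ok Q q ]′
safe-not-ok (new P) s u = safe-not-ok P (s 0) u
safe-not-ok (bang P) s u = safe-not-ok P s u

valuation : Env 0
valuation (fr a) = a

safe-fails : (P : Source) → Safe top valuation P → ¬ ReachesSuccess P
safe-fails P s (_ , ε , u) = safe-not-ok P (safe-blocked P (safe-summand P s)) u
safe-fails P s (_ , r ◅ rs , u) = safe-fails _ (safe-step r valuation s) (_ , rs , u)

-- The source terms

-- The match [2=2] only makes 2 a free name: all sums below then have the same
-- free names and are translated by the same context.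
test : Source
test = matT tt 1 0 (matT tt 2 2 nil)

win lose enabled : Source
win = tau ok
lose = tau nil
enabled = matT tt 2 0 win

-- The final `nil` makes `two-wins` a second application of the parallel context that already gives
-- `one-win`.
one-win two-wins : Source
one-win = win ∥ nil
two-wins = win ∥ (win ∥ nil)

-- The leading `nil` lets one sum context translate both this term and `choice`.
gated : Source → Source
gated P = nil ⊕ (test ∥ P)

alternatives choice : Source
alternatives = enabled ⊕ (test ∥ one-win)
choice = nil ⊕ alternatives

-- The name z is replaced by 0. The continuation `test` of the output keeps 0, 1 and 2 free whatever
-- the input binds, and `lose` puts P beside an active summand.
identify : ℕ → Source → Source
identify z P = outT 0 0 test ∥ inpT 0 z (P ⊕ lose)

gated-reaches : (P : Source) → ReachesSuccess (gated (win ∥ P))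
gated-reaches P = reach-step
  (r-struc (trans≡ sum-comm (trans≡ sum-unit par-comm))
    (r-par (r-par (r-struc (sym≡ sum-unit) r-tau refl≡))) refl≡)
  (_ , ε , inj₁ (inj₁ tt))

handshake : {x y : Nm n} {P : Proc m (suc n)} {Q : Proc m n} → out x y Q ∥ inp x P ⟶ (P [ y ]) ∥ Q
handshake = r-struc
  (trans≡ par-comm (trans≡ (c-parˡ (sym≡ sum-unit)) (c-parʳ (sym≡ sum-unit)))) r-com refl≡

identify₂-choice : ReachesSuccess (identify 2 choice)
identify₂-choice = reach-step handshake (reach-step
  (r-par (r-struc
    (trans≡ (c-sumˡ (trans≡ sum-comm (trans≡ sum-unit (c-sumˡ mat-refl)))) sum-assoc)
    r-tau refl≡))
  (_ , ε , inj₁ tt))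

-- With 0 for 1, `test` becomes congruent to `nil`, and `win` is left as a summand.
identify₁-gated : ReachesSuccess (identify 1 (gated one-win))
identify₁-gated = reach-step handshake (reach-step
  (r-par (r-struc
    (c-sumˡ (trans≡ sum-comm (trans≡ sum-unit (trans≡ (c-parˡ (trans≡ mat-refl mat-refl))
      (trans≡ par-comm (trans≡ par-unit par-unit))))))
    r-tau refl≡))
  (_ , ε , inj₁ tt))

-- Whatever is received for 2, the names 1 and 0 differ, so `test` stays active and blocks
-- `one-win`.
identify₂-gated : ¬ ReachesSuccess (identify 2 (gated one-win))
identify₂-gated = safe-fails _ (out-safe , inp-safe , (λ _ → inp-safe) , (λ _ → out-safe))
  where
  out-safe : 1 ≡ 0 → 2 ≡ 2 → ⊤
  out-safe _ _ = tt

  inp-safe : Safe top valuation (inpT 0 2 (gated one-win ⊕ lose))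
  inp-safe v = (tt , blocks , (λ _ → blocks) , (λ _ → tt)) , tt , (λ _ → tt) , (λ ())
    where
    blocks : Safe summand (valuation ▸ v) (close 2 (test ∥ one-win))
    blocks = (λ _ _ → tt) , (tt , tt , (λ _ → tt) , (λ _ → tt)) , (λ { (() , _) }) , (λ { (() , _) })

-- Even for a value that makes `test` inert, the two copies of `win` block each other.
identify₁-gated₂ : ¬ ReachesSuccess (identify 1 (gated two-wins))
identify₁-gated₂ = safe-fails _ (out-safe , inp-safe , (λ _ → inp-safe) , (λ _ → out-safe))
  where
  out-safe : 1 ≡ 0 → 2 ≡ 2 → ⊤
  out-safe _ _ = tt

  inp-safe : Safe top valuation (inpT 0 1 (gated two-wins ⊕ lose))
  inp-safe v = (tt , blocks , (λ _ → blocks) , (λ _ → tt)) , tt , (λ _ → tt) , (λ ())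
    where
    both : Safe blocked (valuation ▸ v) (close 1 two-wins)
    both = tt , (tt , tt , (λ _ → tt) , (λ _ → tt)) , (λ _ → tt , tt , (λ _ → tt) , (λ _ → tt)) , (λ _ → tt)

    blocks : Safe summand (valuation ▸ v) (close 1 (test ∥ two-wins))
    blocks = (λ _ _ → tt) , both ,
      (λ _ → tt , (tt , tt , (λ _ → tt) , (λ _ → tt)) , (λ ()) , (λ { (() , _) })) , (λ { (() , _) })

nil-fails : ¬ ReachesSuccess {true} nil
nil-fails = safe-fails nil tt

enabled-fails : ¬ ReachesSuccess enabled
enabled-fails = safe-fails enabled (λ ())

-- Free names of the source terms

N₀₁₂ : List ℕ
N₀₁₂ = 0 ∷ 1 ∷ 2 ∷ []

record Within (N : List ℕ) (P : Source) : Set where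
  constructor within
  field all-in : ∀ a → FreeIn a P → a ∈ N

record Covers (N : List ℕ) (P : Source) : Set where
  constructor covers
  field all-free : ∀ a → a ∈ N → FreeIn a P

open Within
open Covers

sum-within : ∀ {N P Q} → Within N P → Within N Q → Within N (P ⊕ Q)
sum-within w w' = within (λ a → [ all-in w a , all-in w' a ]′)

par-within : ∀ {N P Q} → Within N P → Within N Q → Within N (P ∥ Q)
par-within w w' = within (λ a → [ all-in w a , all-in w' a ]′)

inp-within : ∀ z {P} → Within N₀₁₂ P → Within N₀₁₂ (inpT 0 z P)
inp-within z {P} w = within λ
  { _ (inj₁ refl) → here refl
  ; a (inj₂ q) → all-in w a (proj₁ (free-rename⁻ (free-closeN⁻ z) P q)) }

nil-within : ∀ {N} → Within N nil
nil-within = within (λ _ ())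

win-within : ∀ {N} → Within N win
win-within = within (λ _ ())

lose-within : ∀ {N} → Within N lose
lose-within = within (λ _ ())

one-win-within : ∀ {N} → Within N one-win
one-win-within = par-within win-within nil-within

two-wins-within : ∀ {N} → Within N two-wins
two-wins-within = par-within win-within one-win-within

test-within : Within N₀₁₂ test
test-within = within λ
  { _ (inj₁ refl) → there (here refl)
  ; _ (inj₂ (inj₁ refl)) → here refl
  ; _ (inj₂ (inj₂ (inj₁ refl))) → there (there (here refl))
  ; _ (inj₂ (inj₂ (inj₂ (inj₁ refl)))) → there (there (here refl)) }

test-covers : Covers N₀₁₂ test
test-covers = covers λ
  { _ (here refl) → inj₂ (inj₁ refl)
  ; _ (there (here refl)) → inj₁ refl
  ; _ (there (there (here refl))) → inj₂ (inj₂ (inj₁ refl)) }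

enabled-within : Within N₀₁₂ enabled
enabled-within = within λ
  { _ (inj₁ refl) → there (there (here refl))
  ; _ (inj₂ (inj₁ refl)) → here refl }

gate-within : ∀ {P} → Within N₀₁₂ P → Within N₀₁₂ (test ∥ P)
gate-within = par-within test-within

gate-covers : ∀ {P} → Covers N₀₁₂ (test ∥ P)
gate-covers = covers (λ a → inj₁ ∘ all-free test-covers a)

gated-within : ∀ {P} → Within N₀₁₂ P → Within N₀₁₂ (gated P)
gated-within w = sum-within nil-within (gate-within w)

gated-covers : ∀ {P} → Covers N₀₁₂ (gated P)
gated-covers {P} = covers (λ a → inj₂ ∘ all-free (gate-covers {P}) a)

alternatives-within : Within N₀₁₂ alternatives
alternatives-within = sum-within enabled-within (gate-within one-win-within)

alternatives-covers : Covers N₀₁₂ alternatives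
alternatives-covers = covers (λ a → inj₂ ∘ all-free (gate-covers {one-win}) a)

pair : {A : Set} → A → A → Fin 2 → A
pair x y zero = x
pair x y (suc zero) = y

record HasNames {k : ℕ} (N : List ℕ) (S : Fin k → Source) : Set where
  constructor has-names
  field names-⇔ : ∀ a → (a ∈ N) ⇔ (∃[ i ] FreeIn a (S i))

open HasNames

names₁ : ∀ {N P} → Within N P → Covers N P → HasNames {1} N (λ _ → P)
names₁ w c = has-names λ a → mk⇔ (λ q → zero , all-free c a q) (λ (_ , q) → all-in w a q)

namesˡ : ∀ {N P Q} → Within N P → Within N Q → Covers N P → HasNames N (pair P Q)
namesˡ w w' c = has-names λ a → mk⇔ (λ q → zero , all-free c a q)
  (λ { (zero , q) → all-in w a q ; (suc zero , q) → all-in w' a q })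

namesʳ : ∀ {N P Q} → Within N P → Within N Q → Covers N Q → HasNames N (pair P Q)
namesʳ w w' c = has-names λ a → mk⇔ (λ q → suc zero , all-free c a q)
  (λ { (zero , q) → all-in w a q ; (suc zero , q) → all-in w' a q })

-- Dropping an inert thread would leave the empty list, which cannot win.
wins-active : Wins (P ∷ []) → ¬ Inert P
wins-active {P = P} (d , w) i with drop-inert P i w
... | w-ok () _
... | w-split () _ _
... | w-new () _
... | w-tau () _ _
... | w-com () _ _ _ _

-- Comparison of translations and the contradiction

module _ (E : ValidEncoding) where
  open ValidEncoding E

  ctx : (op : Op l) → List ℕ → Ctx false l
  ctx op N = proj₁ (compositional op N)

  translate : (op : Op l) (N : List ℕ) {S : Fin l → Source} → HasNames N S →
    ⟦ applyOp op S ⟧ ≡ fill (ctx op N) (λ i → ⟦ S i ⟧)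
  translate op N {S} c = proj₂ (compositional op N) S (names-⇔ c)

  op-▷ : ∀ {T₁ T₂} (r : T₁ ≼ T₂) (op : Op l) (N : List ℕ) {S S' : Fin l → Source} →
    HasNames N S → HasNames N S' → (∀ i → _▷_ r ⟦ S i ⟧ ⟦ S' i ⟧) →
    _▷_ r ⟦ applyOp op S ⟧ ⟦ applyOp op S' ⟧
  op-▷ r op N c c' h = subst₂ (_▷_ r) (sym (translate op N c)) (sym (translate op N c'))
    (▷-fill r (ctx op N) h)

  -- P and Q have the same free names, so sum, input and parallel composition are translated around
  -- both by the same contexts.
  identify-mono : ∀ z {P Q} → Within N₀₁₂ P → Covers N₀₁₂ P → Within N₀₁₂ Q → Covers N₀₁₂ Q →
    ⟦ P ⟧ ≼ ⟦ Q ⟧ → ReachesSuccess (identify z P) → ReachesSuccess (identify z Q)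
  identify-mono z {P} {Q} wP cP wQ cQ r s = Equivalence.from succ-sens
    (▷-reach r whole (Equivalence.to succ-sens s))
    where
    out-within : Within N₀₁₂ (outT 0 0 test)
    out-within = within λ
      { _ (inj₁ refl) → here refl
      ; _ (inj₂ (inj₁ refl)) → here refl
      ; a (inj₂ (inj₂ q)) → all-in test-within a q }

    out-covers : Covers N₀₁₂ (outT 0 0 test)
    out-covers = covers (λ a → inj₂ ∘ inj₂ ∘ all-free test-covers a)

    body-within : ∀ {R} → Within N₀₁₂ R → Within N₀₁₂ (R ⊕ lose)
    body-within w = sum-within w lose-within

    body-covers : ∀ {R} → Covers N₀₁₂ R → Covers N₀₁₂ (R ⊕ lose)
    body-covers c = covers (λ a → inj₁ ∘ all-free c a)

    sums : _▷_ r ⟦ P ⊕ lose ⟧ ⟦ Q ⊕ lose ⟧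
    sums = op-▷ r o-sum N₀₁₂ (namesˡ wP lose-within cP) (namesˡ wQ lose-within cQ)
      (λ { zero → ▷-here id (sym (rename-id (λ _ → refl) _)) (sym (rename-id (λ _ → refl) _))
         ; (suc zero) → ▷-refl r _ })

    inps : _▷_ r ⟦ inpT 0 z (P ⊕ lose) ⟧ ⟦ inpT 0 z (Q ⊕ lose) ⟧
    inps = op-▷ r (o-inp 0 z) N₀₁₂
      (names₁ (body-within wP) (body-covers cP)) (names₁ (body-within wQ) (body-covers cQ))
      (λ _ → sums)

    whole : _▷_ r ⟦ identify z P ⟧ ⟦ identify z Q ⟧
    whole = op-▷ r o-par N₀₁₂
      (namesˡ out-within (inp-within z (body-within wP)) out-covers)
      (namesˡ out-within (inp-within z (body-within wQ)) out-covers)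
      (λ { zero → ▷-refl r _ ; (suc zero) → inps })

  fails-not-ok : {P : Source} → ¬ ReachesSuccess P → ¬ Unguarded✓ ⟦ P ⟧
  fails-not-ok f u = f (Equivalence.from succ-sens (_ , ε , u))

  gated≡ : ∀ {P} → Within N₀₁₂ P →
    ⟦ gated P ⟧ ≡ fill (ctx o-sum N₀₁₂) (λ i → ⟦ pair nil (test ∥ P) i ⟧)
  gated≡ {P} w = translate o-sum N₀₁₂ (namesʳ nil-within (gate-within w) gate-covers)

  choice≡ : ⟦ choice ⟧ ≡
    fill (ctx o-sum N₀₁₂) (λ i → ⟦ pair nil alternatives i ⟧)
  choice≡ = translate o-sum N₀₁₂ (namesʳ nil-within alternatives-within alternatives-covers)

  alternatives≡ : ⟦ alternatives ⟧ ≡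
    fill (ctx o-sum N₀₁₂) (λ i → ⟦ pair enabled (test ∥ one-win) i ⟧)
  alternatives≡ = translate o-sum N₀₁₂
    (namesʳ enabled-within (gate-within one-win-within) gate-covers)

  gated⇒choice : ∀ {F} → Linear F → F ⟦ gated one-win ⟧ → F ⟦ choice ⟧
  gated⇒choice {F} lin q = subst F (sym choice≡)
    (linear-insert lin (ctx o-sum N₀₁₂) id id (subst F (sym alternatives≡))
      (subst F (gated≡ one-win-within) q))

  -- The extra summand `enabled` fails in the source, so its translation has no unguarded ✓ to
  -- contribute.
  choice⇒gated : Unguarded✓ ⟦ choice ⟧ → Unguarded✓ ⟦ gated one-win ⟧
  choice⇒gated u = subst Unguarded✓ (sym (gated≡ one-win-within))
    (linear-remove ok-linear (ctx o-sum N₀₁₂) id (fails-not-ok enabled-fails) id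
      (subst Unguarded✓ alternatives≡) (subst Unguarded✓ choice≡ u))

  gated-mono : ∀ {F P Q} → Linear F → Within N₀₁₂ P → Within N₀₁₂ Q →
    (F ⟦ P ⟧ → F ⟦ Q ⟧) → F ⟦ gated P ⟧ → F ⟦ gated Q ⟧
  gated-mono {F} {P} {Q} lin wP wQ h q = subst F (sym (gated≡ wQ))
    (linear-mono lin (ctx o-sum N₀₁₂)
      (λ { zero → id
         ; (suc zero) q' → subst F (sym (par≡ wQ)) (linear-mono lin (ctx o-par N₀₁₂)
             (λ { zero → id ; (suc zero) → h }) (subst F (par≡ wP) q')) })
      (subst F (gated≡ wP) q))
    where
    par≡ : ∀ {P} → Within N₀₁₂ P →
      ⟦ test ∥ P ⟧ ≡ fill (ctx o-par N₀₁₂) (λ i → ⟦ pair test P i ⟧)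
    par≡ w = translate o-par N₀₁₂ (namesˡ test-within w test-covers)

  one-win≡ : ⟦ one-win ⟧ ≡ fill (ctx o-par []) (λ i → ⟦ pair win nil i ⟧)
  one-win≡ = translate o-par [] (namesˡ win-within nil-within (covers (λ _ ())))

  two-wins≡ : ⟦ two-wins ⟧ ≡ fill (ctx o-par []) (λ i → ⟦ pair win one-win i ⟧)
  two-wins≡ = translate o-par [] (namesˡ win-within one-win-within (covers (λ _ ())))

  two⇒one : ∀ {F} → Linear F → F ⟦ two-wins ⟧ → F ⟦ one-win ⟧
  two⇒one {F} lin q = subst F (sym one-win≡)
    (linear-merge lin (ctx o-par []) id (subst F one-win≡) (subst F two-wins≡ q))

  -- `nil` fails, so any ✓ exposed by a hole comes from the hole filled with `win`, which both terms
  -- share.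
  one⇒two : Unguarded✓ ⟦ one-win ⟧ → Unguarded✓ ⟦ two-wins ⟧
  one⇒two u = subst Unguarded✓ (sym two-wins≡)
    (linear-mono ok-linear (ctx o-par [])
      (λ { zero → id ; (suc zero) u' → ⊥-elim (fails-not-ok nil-fails u') })
      (subst Unguarded✓ one-win≡ u))

  gated-wins : ∀ P → Wins (⟦ gated (win ∥ P) ⟧ ∷ [])
  gated-wins P = reach⇒wins (Equivalence.to succ-sens (gated-reaches P))

  -- Otherwise the translation of gated one-win would succeed inside every sum
  -- that exposes it, and identifying 0 with 2 would make it succeed as choice does.
  gated-offers-nothing : ∀ {π} → ¬ ⟦ gated one-win ⟧ ↘ π
  gated-offers-nothing o = identify₂-gated (identify-mono 2
    (sum-within nil-within alternatives-within) (covers (λ a → inj₂ ∘ all-free alternatives-covers a))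
    (gated-within one-win-within) gated-covers choice≼gated identify₂-choice)
    where
    choice≼gated : ⟦ choice ⟧ ≼ ⟦ gated one-win ⟧
    choice≼gated = record
      -- `gated one-win` is active because it wins, and activity is linear, so it passes to
      -- `choice`.
      { active = λ i → wins-active (gated-wins nil) (i ∘ gated⇒choice act-linear)
      ; names = λ a → gated⇒choice (free-linear a)
      ; oks = choice⇒gated
      ; wins = gated-wins nil
      ; offers = inj₂ (offers⇒eager o (gated-wins nil)) }

  -- Names must not grow, which uses idempotence from two copies to one; ✓ must not be lost, which
  -- goes from one copy to two.
  one≼two : ⟦ gated one-win ⟧ ≼ ⟦ gated two-wins ⟧
  one≼two = record
    { active = wins-active (gated-wins nil)
    ; names = λ a → gated-mono (free-linear a) two-wins-within one-win-within (two⇒one (free-linear a))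
    ; oks = gated-mono ok-linear one-win-within two-wins-within one⇒two
    ; wins = gated-wins one-win
    ; offers = inj₁ gated-offers-nothing }

  contradiction : ⊥
  contradiction = identify₁-gated₂ (identify-mono 1
    (gated-within one-win-within) gated-covers
    (gated-within two-wins-within) gated-covers one≼two identify₁-gated)

theorem13 : ¬ ValidEncoding
theorem13 = contradiction
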